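{- Let $0\le k\le d$ be integers, and let $\mathcal{F}_1,\dots,\mathcal{F}_{d-k+1}$ be finite families of closed convex sets in $\mathbb{R}^d$. Suppose that for every choice of $F_1\in\mathcal{F}_1,\dots,F_{d-k+1}\in\mathcal{F}_{d-k+1}$ the intersection $\bigcap_{i=1}^{d-k+1}F_i$ contains a $k$-flat. Then there is some $i\in\{1,\dots,d-k+1\}$ such that $\bigcap\mathcal{F}_i$ contains a $k$-flat.
   Context: A $k$-flat in $\mathbb{R}^d$ is a $k$-dimensional affine subspace (a $0$-flat is a point). $\bigcap\mathcal{F}$ denotes the intersection of all sets in the family $\mathcal{F}$; the intersection of an empty family is taken to be $\mathbb{R}^d$. -}

module Defs where

open import Algebra.Bundles using (CommutativeRing)
open import Data.Nat.Base using (ℕ)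
open import Data.Fin.Base using (Fin)
open import Data.Product.Base using (∃-syntax; _×_)
open import Data.Vec.Functional using (Vector)
import Data.Vec.Functional.Relation.Binary.Equality.Setoid as VectorEquality
open import Level using (0ℓ; suc)
open import Relation.Binary.Core using (Rel)
open import Relation.Binary.Structures using (IsTotalOrder)
import Relation.Binary.Construct.NonStrictToStrict as NonStrictToStrict
open import Relation.Nullary.Negation.Core using (¬_)
open import Relation.Unary using (Pred; _∈_; _⊆_; Satisfiable)
import Algebra.Properties.Semiring.Sum as SemiringSum

-- ℝ is used through its axiomatic characterisation: a Dedekind-complete
-- totally ordered field, which is unique up to isomorphism (classically).

record CompleteOrderedField : Set (suc 0ℓ) where
  field
    commutativeRing : CommutativeRing 0ℓ 0ℓ

  open CommutativeRing commutativeRing public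

  infix 4 _≤_
  field
    _≤_           : Rel Carrier 0ℓ
    isTotalOrder  : IsTotalOrder _≈_ _≤_
    +-monoˡ-≤     : ∀ z {x y} → x ≤ y → x + z ≤ y + z
    *-nonNegative : ∀ {x y} → 0# ≤ x → 0# ≤ y → 0# ≤ x * y
    0≉1           : ¬ (0# ≈ 1#)
    inverse       : ∀ x → ¬ (x ≈ 0#) → ∃[ y ] x * y ≈ 1#

  UpperBound : Pred Carrier 0ℓ → Pred Carrier 0ℓ
  UpperBound P b = ∀ x → x ∈ P → x ≤ b

  LeastUpperBound : Pred Carrier 0ℓ → Pred Carrier 0ℓ
  LeastUpperBound P s = s ∈ UpperBound P × (∀ b → b ∈ UpperBound P → s ≤ b)

  field
    complete : (P : Pred Carrier 0ℓ) → Satisfiable P →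
               Satisfiable (UpperBound P) → Satisfiable (LeastUpperBound P)

  open NonStrictToStrict _≈_ _≤_ public using (_<_)

module EuclideanSpace (ℝ : CompleteOrderedField) where

  open CompleteOrderedField ℝ
  open VectorEquality setoid using (_≋_)
  open SemiringSum semiring using (sum)

  ℝ^_ : ℕ → Set
  ℝ^ d = Vector Carrier d

  linearCombination : ∀ {k d} → Vector Carrier k → Vector (ℝ^ d) k → ℝ^ d
  linearCombination c v i = sum (λ j → c j * v j i)

  LinearlyIndependent : ∀ {k d} → Vector (ℝ^ d) k → Set
  LinearlyIndependent v =
    ∀ c → linearCombination c v ≋ (λ _ → 0#) → ∀ j → c j ≈ 0#

  record Flat (k d : ℕ) : Set where
    field
      base        : ℝ^ d
      direction   : Vector (ℝ^ d) k
      independent : LinearlyIndependent direction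

    points : Pred (ℝ^ d) 0ℓ
    points x = ∃[ c ] x ≋ (λ i → base i + linearCombination c direction i)

  ContainsFlat : ∀ {d} → ℕ → Pred (ℝ^ d) 0ℓ → Set
  ContainsFlat {d} k S = ∃[ L ] Flat.points {k} {d} L ⊆ S

  Convex : ∀ {d} → Pred (ℝ^ d) 0ℓ → Set
  Convex S = ∀ x y t → x ∈ S → y ∈ S → 0# ≤ t → t ≤ 1# →
             (λ i → (1# - t) * x i + t * y i) ∈ S

  distance² : ∀ {d} → ℝ^ d → ℝ^ d → Carrier
  distance² x y = sum (λ i → (x i - y i) * (x i - y i))

  -- For ε > 0, distance² x y < ε * ε says that y is in the open Euclidean
  -- ball of radius ε about x.
  Adherent : ∀ {d} → Pred (ℝ^ d) 0ℓ → Pred (ℝ^ d) 0ℓ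
  Adherent S x = ∀ ε → 0# < ε → ∃[ y ] y ∈ S × distance² x y < ε * ε

  -- A closed predicate automatically respects _≋_, since x ≋ y ∈ S makes x
  -- adherent to S.  So closed predicates are genuine subsets of ℝ^ d.
  Closed : ∀ {d} → Pred (ℝ^ d) 0ℓ → Set
  Closed S = Adherent S ⊆ S

{-# OPTIONS --safe #-}
module Submission where

-- Replace every F i j by its lineality space; its codimension is a submodular function of
-- intersections.  If every set I of families had a total lineality space of codimension at
-- least ∣ I ∣, Rado's transversal theorem would select one set from each family so that the
-- common lineality space has codimension greater than d - k, against the hypothesis that the
-- selected sets share a k-flat.  So for some I the lineality spaces of all sets in the families
-- of I meet in a space L of codimension less than ∣ I ∣.  These sets are invariant under L, so
-- modulo L they live in dimension less than ∣ I ∣, and the colorful Helly theorem for the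
-- families of I gives some i ∈ I and a point common to all F i j.  The translate of L through
-- that point lies in every F i j and contains a k-flat.

-- Lineality is the right invariant because a closed convex set that contains a line also contains
-- the parallel line through each of its points. Whether an intersection contains a `k`-flat
-- therefore depends on two things only: that it is nonempty, and that the lineality spaces share
-- `k` independent directions. The numbers fit exactly: colorful Helly for ∣ I ∣ families works in
-- dimension ∣ I ∣ - 1, and this is what a failure of Rado's condition at I provides. The objects
-- selected are subspaces rather than elements of a matroid, so one choice may raise the codimension
-- by more than one. Rado's argument survives because it uses nothing but submodularity. No
-- dimension is computed and no quotient is formed. Codimension enters through lower bounds
-- witnessed by independent vectors, with upper bounds as their negations; excluded middle turns a
-- failed bound into a linear dependence. Colorful Helly is proved inside ℝ^d for sets invariant
-- under L, with Radon's theorem applied modulo L.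

open import Defs
open import Algebra.Solver.Ring.AlmostCommutativeRing using (fromCommutativeRing; _-Raw-AlmostCommutative⟶_)
import Algebra.Solver.Ring as RingSolver
open import Axiom.ExcludedMiddle using (ExcludedMiddle)
open import Data.Bool.Base using (if_then_else_)
open import Data.Fin.Base using (Fin; zero; suc; punchIn; _↑ˡ_; _↑ʳ_; splitAt; join)
open import Data.Fin.Properties using (_≟_; any?; suc-injective; punchInᵢ≢i; join-splitAt)
open import Data.Fin.Subset as Subset using (Subset; inside; outside; ∣_∣)
open import Data.Fin.Subset.Properties using (∣⊥∣≡0; ∣⊤∣≡n; ∣p∣≤n; ∉⊥; x∈p∪q⁻; p∩q⊆p; p∩q⊆q)
open import Data.Integer.Base as ℤ using (ℤ; +_; -[1+_])
import Data.Integer.Properties as ℤ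
open import Data.Maybe.Base using (Maybe; just; nothing)
open import Data.Nat.Base as ℕ using (ℕ; zero; suc; _∸_)
import Data.Nat.Properties as ℕ
open import Data.Nat.Solver using (module +-*-Solver)
open import Data.Product.Base using (∃-syntax; Σ-syntax; _×_; _,_; proj₁; proj₂)
open import Data.Sum.Base using (_⊎_; inj₁; inj₂; [_,_]′)
open import Data.Unit.Base using (tt)
open import Data.Vec.Base as Vec using (here; there)
open import Data.Vec.Functional as Vector using (Vector; _++_; insertAt; removeAt; tail)
open import Data.Vec.Functional.Properties using (insertAt-lookup; insertAt-punchIn; lookup-++ˡ; lookup-++ʳ)
import Data.Vec.Functional.Relation.Binary.Equality.Setoid as VectorEquality
open import Function.Base using (_∘_)
open import Function.Definitions using (Injective)
open import Level using (0ℓ)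
open import Relation.Binary.PropositionalEquality as ≡ using (_≡_; _≢_; cong; cong₂; subst)
open import Relation.Binary.Structures using (IsTotalOrder)
open import Relation.Nullary using (¬_; Dec; yes; no; does; contradiction)
open import Relation.Nullary.Decidable using (dec-true; dec-false; decidable-stable)
open import Relation.Unary using (Pred; _∈_; _⊆_; _∩_; U; Satisfiable; ⋂)

-- Ordered field arithmetic and a ring solver with integer coefficients.

module OrderedField (em : ExcludedMiddle 0ℓ) (ℝ : CompleteOrderedField) where
  open CompleteOrderedField ℝ
  open import Algebra.Properties.Ring ring using (-‿distribˡ-*; -‿distribʳ-*)
  open import Algebra.Properties.Group +-group using (⁻¹-involutive)
  open import Algebra.Properties.AbelianGroup +-abelianGroup using (⁻¹-∙-comm)
  open import Algebra.Properties.Semiring.Mult.TCOptimised semiring using (×-homo-+; ×1-homo-*; 1+×) renaming (_×_ to _×ₙ_)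
  open import Relation.Binary.Reasoning.Setoid setoid

  -- The ring solver decides equality of coefficients by computation, so they are taken in ℤ:
  -- excluded middle on ℝ does not compute.
  fromℤ : ℤ → Carrier
  fromℤ (+ n)    = n ×ₙ 1#
  fromℤ -[1+ n ] = - (suc n ×ₙ 1#)

  fromℤ-neg : ∀ i → fromℤ (ℤ.- i) ≈ - fromℤ i
  fromℤ-neg (+ zero)    = sym (trans (sym (+-identityˡ _)) (-‿inverseʳ 0#))
  fromℤ-neg (+ suc n)   = refl
  fromℤ-neg -[1+ n ]    = sym (⁻¹-involutive _)

  fromℤ-⊖ : ∀ m n → fromℤ (m ℤ.⊖ n) ≈ m ×ₙ 1# - n ×ₙ 1#
  fromℤ-⊖ zero    zero    = trans (sym (+-identityˡ _)) (+-congˡ (fromℤ-neg (+ 0)))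
  fromℤ-⊖ zero    (suc n) = sym (+-identityˡ _)
  fromℤ-⊖ (suc m) zero    = begin
    suc m ×ₙ 1#      ≈⟨ +-identityʳ _ ⟨
    suc m ×ₙ 1# + 0# ≈⟨ +-congˡ (fromℤ-neg (+ 0)) ⟩
    suc m ×ₙ 1# - 0# ∎
  fromℤ-⊖ (suc m) (suc n) = begin
    fromℤ (suc m ℤ.⊖ suc n)              ≈⟨ reflexive (cong fromℤ (ℤ.[1+m]⊖[1+n]≡m⊖n m n)) ⟩
    fromℤ (m ℤ.⊖ n)                      ≈⟨ fromℤ-⊖ m n ⟩
    m ×ₙ 1# - n ×ₙ 1#                    ≈⟨ +-congʳ (+-identityʳ _) ⟨
    m ×ₙ 1# + 0# - n ×ₙ 1#               ≈⟨ +-congʳ (+-congˡ (-‿inverseʳ 1#)) ⟨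
    m ×ₙ 1# + (1# - 1#) - n ×ₙ 1#        ≈⟨ +-congʳ (+-assoc _ _ _) ⟨
    m ×ₙ 1# + 1# - 1# - n ×ₙ 1#          ≈⟨ +-assoc _ _ _ ⟩
    m ×ₙ 1# + 1# + (- 1# - n ×ₙ 1#)      ≈⟨ +-cong (+-comm _ _) (⁻¹-∙-comm _ _) ⟩
    1# + m ×ₙ 1# - (1# + n ×ₙ 1#)        ≈⟨ +-cong (1+× m 1#) (-‿cong (1+× n 1#)) ⟨
    suc m ×ₙ 1# - suc n ×ₙ 1#            ∎

  fromℤ-+ : ∀ i j → fromℤ (i ℤ.+ j) ≈ fromℤ i + fromℤ j
  fromℤ-+ (+ m)    (+ n)    = ×-homo-+ 1# m n
  fromℤ-+ (+ m)    -[1+ n ] = fromℤ-⊖ m (suc n)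
  fromℤ-+ -[1+ m ] (+ n)    = trans (fromℤ-⊖ n (suc m)) (+-comm _ _)
  fromℤ-+ -[1+ m ] -[1+ n ] = begin
    - (suc (suc (m ℕ.+ n)) ×ₙ 1#)   ≈⟨ reflexive (cong (λ k → - (suc k ×ₙ 1#)) (≡.sym (ℕ.+-suc m n))) ⟩
    - ((suc m ℕ.+ suc n) ×ₙ 1#)     ≈⟨ -‿cong (×-homo-+ 1# (suc m) (suc n)) ⟩
    - (suc m ×ₙ 1# + suc n ×ₙ 1#)   ≈⟨ ⁻¹-∙-comm _ _ ⟨
    - (suc m ×ₙ 1#) - suc n ×ₙ 1#   ∎

  fromℤ-*-pos : ∀ m j → fromℤ (+ m ℤ.* j) ≈ m ×ₙ 1# * fromℤ j
  fromℤ-*-pos m (+ n)    = trans (reflexive (cong fromℤ (≡.sym (ℤ.pos-* m n)))) (×1-homo-* m n)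
  fromℤ-*-pos m -[1+ n ] = begin
    fromℤ (+ m ℤ.* -[1+ n ])          ≈⟨ reflexive (cong fromℤ (ℤ.neg-distribʳ-* (+ m) (+ suc n))) ⟨
    fromℤ (ℤ.- (+ m ℤ.* + suc n))     ≈⟨ fromℤ-neg (+ m ℤ.* + suc n) ⟩
    - fromℤ (+ m ℤ.* + suc n)         ≈⟨ -‿cong (fromℤ-*-pos m (+ suc n)) ⟩
    - (m ×ₙ 1# * suc n ×ₙ 1#)         ≈⟨ -‿distribʳ-* _ _ ⟩
    m ×ₙ 1# * - (suc n ×ₙ 1#)         ∎

  fromℤ-* : ∀ i j → fromℤ (i ℤ.* j) ≈ fromℤ i * fromℤ j
  fromℤ-* (+ m)    j = fromℤ-*-pos m j
  fromℤ-* -[1+ m ] j = begin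
    fromℤ (-[1+ m ] ℤ.* j)            ≈⟨ reflexive (cong fromℤ (ℤ.neg-distribˡ-* (+ suc m) j)) ⟨
    fromℤ (ℤ.- (+ suc m ℤ.* j))       ≈⟨ fromℤ-neg (+ suc m ℤ.* j) ⟩
    - fromℤ (+ suc m ℤ.* j)           ≈⟨ -‿cong (fromℤ-*-pos (suc m) j) ⟩
    - (suc m ×ₙ 1# * fromℤ j)         ≈⟨ -‿distribˡ-* _ _ ⟩
    - (suc m ×ₙ 1#) * fromℤ j         ∎

  private
    fromℤ-morphism : ℤ.+-*-rawRing -Raw-AlmostCommutative⟶ fromCommutativeRing commutativeRing
    fromℤ-morphism = record
      { ⟦_⟧ = fromℤ ; +-homo = fromℤ-+ ; *-homo = fromℤ-* ; -‿homo = fromℤ-neg ; 0-homo = refl ; 1-homo = refl }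

    weaklyEqual : ∀ i j → Maybe (fromℤ i ≈ fromℤ j)
    weaklyEqual i j with i ℤ.≟ j
    ... | yes ≡.refl = just refl
    ... | no _       = nothing

  open RingSolver ℤ.+-*-rawRing (fromCommutativeRing commutativeRing) fromℤ-morphism weaklyEqual public
    using (solve; con; _:=_; _:+_; _:*_; _:-_; :-_; Polynomial)

  open IsTotalOrder isTotalOrder public
    using (total; antisym; ≤-respˡ-≈; ≤-respʳ-≈)
    renaming (refl to ≤-refl; reflexive to ≤-reflexive; trans to ≤-trans)

  :0 :1 : ∀ {n} → Polynomial n
  :0 = con (+ 0)
  :1 = con (+ 1)

  0≤y-x⇒x≤y : ∀ {x y} → 0# ≤ y - x → x ≤ y
  0≤y-x⇒x≤y {x} {y} 0≤y-x = ≤-respˡ-≈ (+-identityˡ x) (≤-respʳ-≈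
    (solve 2 (λ x y → y :- x :+ x := y) refl x y) (+-monoˡ-≤ x 0≤y-x))

  x≤y⇒0≤y-x : ∀ {x y} → x ≤ y → 0# ≤ y - x
  x≤y⇒0≤y-x {x} x≤y = ≤-respˡ-≈ (-‿inverseʳ x) (+-monoˡ-≤ (- x) x≤y)

  ≤-by : ∀ {x y} e → y - x ≈ e → 0# ≤ e → x ≤ y
  ≤-by e y-x≈e 0≤e = 0≤y-x⇒x≤y (≤-respʳ-≈ (sym y-x≈e) 0≤e)

  <-by : ∀ {x y} e → y - x ≈ e → 0# < e → x < y
  <-by {x} {y} e y-x≈e (0≤e , 0≉e) = ≤-by e y-x≈e 0≤e ,
    λ x≈y → 0≉e (trans (sym (-‿inverseʳ y)) (trans (+-congˡ (-‿cong (sym x≈y))) y-x≈e))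

  +-mono-≤ : ∀ {x y u v} → x ≤ y → u ≤ v → x + u ≤ y + v
  +-mono-≤ {x} {y} {u} {v} x≤y u≤v = ≤-trans (+-monoˡ-≤ u x≤y)
    (≤-respˡ-≈ (+-comm u y) (≤-respʳ-≈ (+-comm v y) (+-monoˡ-≤ y u≤v)))

  +-nonNegative : ∀ {x y} → 0# ≤ x → 0# ≤ y → 0# ≤ x + y
  +-nonNegative 0≤x 0≤y = ≤-respˡ-≈ (+-identityˡ 0#) (+-mono-≤ 0≤x 0≤y)

  *-monoˡ-≤ : ∀ {x y z} → 0# ≤ z → x ≤ y → z * x ≤ z * y
  *-monoˡ-≤ {x} {y} {z} 0≤z x≤y = ≤-by (z * (y - x))
    (solve 3 (λ x y z → z :* y :- z :* x := z :* (y :- x)) refl x y z)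
    (*-nonNegative 0≤z (x≤y⇒0≤y-x x≤y))

  x≤0⇒0≤-x : ∀ {x} → x ≤ 0# → 0# ≤ - x
  x≤0⇒0≤-x {x} x≤0 = ≤-respʳ-≈ (+-identityˡ _) (x≤y⇒0≤y-x x≤0)

  square-nonNegative : ∀ x → 0# ≤ x * x
  square-nonNegative x with total 0# x
  ... | inj₁ 0≤x = *-nonNegative 0≤x 0≤x
  ... | inj₂ x≤0 = ≤-respʳ-≈ (solve 1 (λ x → :- x :* :- x := x :* x) refl x)
                     (*-nonNegative (x≤0⇒0≤-x x≤0) (x≤0⇒0≤-x x≤0))

  0≤1 : 0# ≤ 1#
  0≤1 = ≤-respʳ-≈ (*-identityˡ 1#) (square-nonNegative 1#)

  0<1 : 0# < 1#
  0<1 = 0≤1 , 0≉1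

  ≰⇒> : ∀ {x y} → ¬ (x ≤ y) → y < x
  ≰⇒> {x} {y} x≰y with total x y
  ... | inj₁ x≤y = contradiction x≤y x≰y
  ... | inj₂ y≤x = y≤x , λ y≈x → x≰y (≤-reflexive (sym y≈x))

  <⇒≱ : ∀ {x y} → x < y → ¬ (y ≤ x)
  <⇒≱ (x≤y , x≉y) y≤x = x≉y (antisym x≤y y≤x)

  <-≤-trans : ∀ {x y z} → x < y → y ≤ z → x < z
  <-≤-trans x<y y≤z = ≤-trans (proj₁ x<y) y≤z , λ x≈z → <⇒≱ x<y (≤-respʳ-≈ (sym x≈z) y≤z)

  ≤-<-trans : ∀ {x y z} → x ≤ y → y < z → x < z
  ≤-<-trans x≤y y<z = ≤-trans x≤y (proj₁ y<z) , λ x≈z → <⇒≱ y<z (≤-respˡ-≈ x≈z x≤y)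

  ≈? : ∀ x y → Dec (x ≈ y)
  ≈? x y = em

  ≤-stable : ∀ {x y} → ¬ ¬ (x ≤ y) → x ≤ y
  ≤-stable = decidable-stable em

  *-zero-product : ∀ {x y} → ¬ (x ≈ 0#) → x * y ≈ 0# → y ≈ 0#
  *-zero-product {x} {y} x≉0 xy≈0 with x⁻¹ , xx⁻¹≈1 ← inverse x x≉0 = begin
    y               ≈⟨ *-identityˡ y ⟨
    1# * y          ≈⟨ *-congʳ xx⁻¹≈1 ⟨
    x * x⁻¹ * y     ≈⟨ solve 3 (λ x y z → x :* z :* y := z :* (x :* y)) refl x y x⁻¹ ⟩
    x⁻¹ * (x * y)   ≈⟨ *-congˡ xy≈0 ⟩
    x⁻¹ * 0#        ≈⟨ zeroʳ x⁻¹ ⟩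
    0#              ∎

  *-positive : ∀ {x y} → 0# < x → 0# < y → 0# < x * y
  *-positive (0≤x , 0≉x) (0≤y , 0≉y) = *-nonNegative 0≤x 0≤y ,
    λ 0≈xy → 0≉y (sym (*-zero-product (λ x≈0 → 0≉x (sym x≈0)) (sym 0≈xy)))

  +-positiveˡ : ∀ {x y} → 0# < x → 0# ≤ y → 0# < x + y
  +-positiveˡ {x} 0<x 0≤y = <-≤-trans 0<x
    (≤-respˡ-≈ (+-identityʳ x) (+-mono-≤ ≤-refl 0≤y))

  abstract
    positive-inverse : ∀ {x} → 0# < x → ∃[ y ] 0# < y × x * y ≈ 1#
    positive-inverse {x} (0≤x , 0≉x) with y , xy≈1 ← inverse x (λ x≈0 → 0≉x (sym x≈0)) =
      y , ≰⇒> y≰0 , xy≈1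
      where
      y≰0 : ¬ (y ≤ 0#)
      y≰0 y≤0 = <⇒≱ 0<1 (≤-by (x * - y)
        (trans (+-congˡ (-‿cong (sym xy≈1))) (solve 2 (λ x y → :0 :- x :* y := x :* :- y) refl x y))
        (*-nonNegative 0≤x (x≤0⇒0≤-x y≤0)))

  ≤-from-squares : ∀ {x y} → 0# < y → x * x ≤ y * y → x ≤ y
  ≤-from-squares {x} {y} 0<y x²≤y² = ≤-stable λ x≰y → let y<x = ≰⇒> x≰y in
    <⇒≱ (*-positive (x<y⇒0<y-x y<x) (+-positiveˡ 0<y (≤-trans (proj₁ 0<y) (proj₁ y<x))))
      (≤-by (y * y - x * x)
        (solve 2 (λ x y → :0 :- (x :- y) :* (y :+ x) := y :* y :- x :* x) refl x y)
        (x≤y⇒0≤y-x x²≤y²))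
    where
    x<y⇒0<y-x : ∀ {x y} → x < y → 0# < y - x
    x<y⇒0<y-x {x} {y} (x≤y , x≉y) = x≤y⇒0≤y-x x≤y , λ 0≈y-x → x≉y (begin
      x            ≈⟨ +-identityˡ x ⟨
      0# + x       ≈⟨ +-congʳ 0≈y-x ⟩
      y - x + x    ≈⟨ solve 2 (λ x y → y :- x :+ x := y) refl x y ⟩
      y            ∎)

  abstract
    -- The witness is ε / (ε + a): multiplied by `a` it falls short of ε by ε times itself.
    small-factor : ∀ {ε a} → 0# < ε → 0# ≤ a → ∃[ s ] 0# < s × s ≤ 1# × s * a < ε
    small-factor {ε} {a} 0<ε 0≤a
      with r , 0<r , [ε+a]r≈1 ← positive-inverse (+-positiveˡ 0<ε 0≤a) =
      ε * r , 0<εr , s≤1 , s*a<ε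
      where
      0<εr : 0# < ε * r
      0<εr = *-positive 0<ε 0<r

      s≤1 : ε * r ≤ 1#
      s≤1 = ≤-by (a * r)
        (trans (+-congʳ (sym [ε+a]r≈1)) (solve 3 (λ ε a r → (ε :+ a) :* r :- ε :* r := a :* r) refl ε a r))
        (*-nonNegative 0≤a (proj₁ 0<r))

      gap : ε - ε * r * a ≈ ε * (ε * r)
      gap = begin
        ε - ε * r * a                   ≈⟨ +-congʳ (trans (sym (*-identityʳ ε)) (*-congˡ (sym [ε+a]r≈1))) ⟩
        ε * ((ε + a) * r) - ε * r * a   ≈⟨ solve 3 (λ ε a r → ε :* ((ε :+ a) :* r) :- ε :* r :* a := ε :* (ε :* r)) refl ε a r ⟩
        ε * (ε * r)                     ∎

      s*a<ε : ε * r * a < ε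
      s*a<ε = <-by _ gap (*-positive 0<ε 0<εr)

  -- Since a < (1 + a)², bounding s (1 + a) by ε is enough. This avoids a square root of `a`.
  square-factor : ∀ {ε s a} → 0# < s → 0# ≤ a → s * (1# + a) < ε → s * s * a < ε * ε
  square-factor {ε} {s} {a} 0<s 0≤a b<ε = <-≤-trans s²a<b² b²≤ε²
    where
    b = s * (1# + a)

    0≤b : 0# ≤ b
    0≤b = *-nonNegative (proj₁ 0<s) (+-nonNegative 0≤1 0≤a)

    s²a<b² : s * s * a < b * b
    s²a<b² = <-by (s * s * (1# + (a + a * a)))
      (solve 2 (λ s a → s :* (:1 :+ a) :* (s :* (:1 :+ a)) :- s :* s :* a := s :* s :* (:1 :+ (a :+ a :* a))) refl s a)
      (*-positive (*-positive 0<s 0<s) (+-positiveˡ 0<1 (+-nonNegative 0≤a (*-nonNegative 0≤a 0≤a))))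

    b²≤ε² : b * b ≤ ε * ε
    b²≤ε² = ≤-trans (*-monoˡ-≤ 0≤b (proj₁ b<ε))
      (≤-respˡ-≈ (*-comm ε b) (*-monoˡ-≤ (≤-trans 0≤b (proj₁ b<ε)) (proj₁ b<ε)))

  abstract
    small-square-factor : ∀ {ε a} → 0# < ε → 0# ≤ a → ∃[ s ] 0# < s × s ≤ 1# × s * s * a < ε * ε
    small-square-factor 0<ε 0≤a =
      let s , 0<s , s≤1 , b<ε = small-factor 0<ε (+-nonNegative 0≤1 0≤a)
      in s , 0<s , s≤1 , square-factor 0<s 0≤a b<ε

-- Linear independence modulo a subspace, and codimension.

module RankModulo (em : ExcludedMiddle 0ℓ) (ℝ : CompleteOrderedField) where
  open CompleteOrderedField ℝ hiding (zero)
  open Vector using ([]; _∷_)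
  open EuclideanSpace ℝ
  open OrderedField em ℝ
  open VectorEquality setoid using (_≋_; ≋-refl; ≋-sym; ≋-trans)
  open import Algebra.Properties.Semiring.Sum semiring
  open import Relation.Binary.Reasoning.Setoid setoid

  private variable
    a b d n p r : ℕ

  sum-zero : ∀ {n} {f : Vector Carrier n} → (∀ i → f i ≈ 0#) → sum f ≈ 0#
  sum-zero {n} f≈0 = trans (sum-cong-≋ f≈0) (sum-replicate-zero n)

  sum-++ : ∀ m {n} (f : Vector Carrier (m ℕ.+ n)) → sum f ≈ sum (f ∘ (_↑ˡ n)) + sum (f ∘ (m ↑ʳ_))
  sum-++ zero    f = sym (+-identityˡ _)
  sum-++ (suc m) f = trans (+-congˡ (sum-++ m (f ∘ suc))) (sym (+-assoc _ _ _))

  sum-+* : (f g : Vector Carrier n) (t : Carrier) → sum (λ i → f i + t * g i) ≈ sum f + t * sum g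
  sum-+* f g t = trans (∑-distrib-+ f _) (+-congˡ (sym (*-distribˡ-sum t g)))

  unitVector : Fin d → ℝ^ d
  unitVector j i = if does (j ≟ i) then 1# else 0#

  sum-unitVector : ∀ {n} (f : Vector Carrier n) j → sum (λ i → unitVector j i * f i) ≈ f j
  sum-unitVector {suc n} f j = begin
    sum (λ i → unitVector j i * f i)                             ≈⟨ sum-remove {i = j} (λ i → unitVector j i * f i) ⟩
    unitVector j j * f j + sum (λ i → unitVector j (punchIn j i) * f (punchIn j i))
                                                                 ≈⟨ +-cong (*-congʳ diagonal) (sum-zero off-diagonal) ⟩
    1# * f j + 0#                                                ≈⟨ solve 1 (λ x → :1 :* x :+ :0 := x) refl (f j) ⟩
    f j                                                          ∎
    where
    diagonal : unitVector j j ≈ 1#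
    diagonal = reflexive (cong (if_then 1# else 0#) (dec-true (j ≟ j) ≡.refl))
    off-diagonal : ∀ i → unitVector j (punchIn j i) * f (punchIn j i) ≈ 0#
    off-diagonal i = trans (*-congʳ (reflexive (cong (if_then 1# else 0#)
      (dec-false (j ≟ punchIn j i) (punchInᵢ≢i j i ∘ ≡.sym))))) (zeroˡ _)

  linearCombination-zero : ∀ {c : Vector Carrier a} (v : Vector (ℝ^ d) a) →
    (∀ j → c j ≈ 0#) → linearCombination c v ≋ λ _ → 0#
  linearCombination-zero v c≈0 i = sum-zero λ j → trans (*-congʳ (c≈0 j)) (zeroˡ _)

  linearCombination-+* : ∀ (c e : Vector Carrier a) t (v : Vector (ℝ^ d) a) →
    linearCombination (λ j → c j + t * e j) v ≋ λ i → linearCombination c v i + t * linearCombination e v i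
  linearCombination-+* c e t v i = begin
    sum (λ j → (c j + t * e j) * v j i)           ≈⟨ sum-cong-≋ (λ j → solve 4 (λ c t e v → (c :+ t :* e) :* v := c :* v :+ t :* (e :* v)) refl (c j) t (e j) (v j i)) ⟩
    sum (λ j → c j * v j i + t * (e j * v j i))   ≈⟨ sum-+* (λ j → c j * v j i) (λ j → e j * v j i) t ⟩
    sum (λ j → c j * v j i) + t * sum (λ j → e j * v j i)   ∎

  linearCombination-insertAt : ∀ (c : Vector Carrier a) j (v : Vector (ℝ^ d) (suc a)) →
    linearCombination (insertAt c j 0#) v ≋ linearCombination c (removeAt v j)
  linearCombination-insertAt c j v i = begin
    sum (λ l → insertAt c j 0# l * v l i)     ≈⟨ sum-remove {i = j} (λ l → insertAt c j 0# l * v l i) ⟩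
    insertAt c j 0# j * v j i + sum (λ l → insertAt c j 0# (punchIn j l) * v (punchIn j l) i)
      ≈⟨ +-cong (*-congʳ (reflexive (insertAt-lookup c j 0#))) (sum-cong-≋ λ l → *-congʳ (reflexive (insertAt-punchIn c j 0# l))) ⟩
    0# * v j i + linearCombination c (removeAt v j) i  ≈⟨ solve 2 (λ x y → :0 :* x :+ y := y) refl (v j i) _ ⟩
    linearCombination c (removeAt v j) i      ∎

  linearCombination-++ : ∀ (c : Vector Carrier (a ℕ.+ b)) (v : Vector (ℝ^ d) a) (w : Vector (ℝ^ d) b) →
    linearCombination c (v ++ w) ≋ λ i → linearCombination (c ∘ (_↑ˡ b)) v i + linearCombination (c ∘ (a ↑ʳ_)) w i
  linearCombination-++ {a} {b} c v w i = trans (sum-++ a _) (+-cong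
    (sum-cong-≋ λ j → *-congˡ {c (j ↑ˡ b)} (reflexive (cong (λ u → u i) (lookup-++ˡ v w j))))
    (sum-cong-≋ λ j → *-congˡ {c (a ↑ʳ j)} (reflexive (cong (λ u → u i) (lookup-++ʳ v w j)))))

  record IsSubspace (L : Pred (ℝ^ d) 0ℓ) : Set where
    field
      respects : ∀ {x y} → x ≋ y → x ∈ L → y ∈ L
      0∈       : (λ _ → 0#) ∈ L
      +*∈      : ∀ {x y} t → x ∈ L → y ∈ L → (λ i → x i + t * y i) ∈ L

    combination∈ : ∀ {c : Vector Carrier a} {v} → (∀ j → v j ∈ L) → linearCombination c v ∈ L
    combination∈ {zero}          v∈L = 0∈
    combination∈ {suc a} {c} {v} v∈L = respects (λ i → +-comm _ _)
      (+*∈ {linearCombination (tail c) (tail v)} (c zero) (combination∈ (v∈L ∘ suc)) (v∈L zero))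

  open IsSubspace

  U-isSubspace : IsSubspace {d} U
  U-isSubspace = record { respects = _ ; 0∈ = _ ; +*∈ = _ }

  ∩-isSubspace : {K L : Pred (ℝ^ d) 0ℓ} → IsSubspace K → IsSubspace L → IsSubspace (K ∩ L)
  ∩-isSubspace K L = record
    { respects = λ x≋y (x∈K , x∈L) → respects K x≋y x∈K , respects L x≋y x∈L
    ; 0∈       = 0∈ K , 0∈ L
    ; +*∈      = λ t (x∈K , x∈L) (y∈K , y∈L) → +*∈ K t x∈K y∈K , +*∈ L t x∈L y∈L
    }

  ⋂-isSubspace : {I : Set} {L : I → Pred (ℝ^ d) 0ℓ} → (∀ i → IsSubspace (L i)) → IsSubspace (λ x → ∀ i → x ∈ L i)
  ⋂-isSubspace L = record
    { respects = λ x≋y x∈L i → respects (L i) x≋y (x∈L i)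
    ; 0∈       = λ i → 0∈ (L i)
    ; +*∈      = λ t x∈L y∈L i → +*∈ (L i) t (x∈L i) (y∈L i)
    }

  Null : Pred (ℝ^ d) 0ℓ
  Null x = x ≋ λ _ → 0#

  Null-isSubspace : IsSubspace {d} Null
  Null-isSubspace = record
    { respects = λ x≋y x≋0 → ≋-trans (≋-sym x≋y) x≋0
    ; 0∈       = ≋-refl
    ; +*∈      = λ t x≋0 y≋0 i → trans (+-cong (x≋0 i) (*-congˡ (y≋0 i)))
                   (solve 1 (λ t → :0 :+ t :* :0 := :0) refl t)
    }

  IndependentModulo : Pred (ℝ^ d) 0ℓ → Vector (ℝ^ d) a → Set
  IndependentModulo L v = ∀ c → linearCombination c v ∈ L → ∀ j → c j ≈ 0#

  -- The vectors are independent in the quotient by `L`. The upper bound "codimension at most a" is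
  -- expressed as `¬ Codim≥ L (suc a)`.
  Codim≥ : Pred (ℝ^ d) 0ℓ → ℕ → Set
  Codim≥ L a = ∃[ v ] IndependentModulo {a = a} L v

  Codim≥-mono : (K L : Pred (ℝ^ d) 0ℓ) → K ⊆ L → Codim≥ L a → Codim≥ K a
  Codim≥-mono K L K⊆L (v , indep) = v , λ c c∈K → indep c (K⊆L c∈K)

  dependence : (L : Pred (ℝ^ d) 0ℓ) (v : Vector (ℝ^ d) a) → ¬ IndependentModulo L v →
    ∃[ c ] linearCombination c v ∈ L × ∃[ j ] ¬ (c j ≈ 0#)
  dependence L v dep = decidable-stable em λ none → dep λ c c∈L j →
    decidable-stable (≈? (c j) 0#) λ cj≉0 → none (c , c∈L , j , cj≉0)

  Codim≥-suc : {L : Pred (ℝ^ d) 0ℓ} → IsSubspace L → Codim≥ L (suc a) → Codim≥ L a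
  Codim≥-suc L (v , indep) = tail v , λ c c∈L j → indep (0# ∷ c)
    (respects L (λ i → sym (trans (+-congʳ (zeroˡ _)) (+-identityˡ _))) c∈L) (suc j)

  Codim≥-+ : {L : Pred (ℝ^ d) 0ℓ} → IsSubspace L → ∀ b → Codim≥ L (b ℕ.+ a) → Codim≥ L a
  Codim≥-+ L zero    rank = rank
  Codim≥-+ L (suc b) rank = Codim≥-+ L b (Codim≥-suc L rank)

  Codim≥-antitone : {L : Pred (ℝ^ d) 0ℓ} → IsSubspace L → a ℕ.≤ b → Codim≥ L b → Codim≥ L a
  Codim≥-antitone {a = a} {b} {L} L-sub a≤b codim =
    Codim≥-+ L-sub (b ∸ a) (subst (Codim≥ L) (≡.sym (ℕ.m∸n+n≡m a≤b)) codim)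

  module _ {K : Pred (ℝ^ d) 0ℓ} (K-sub : IsSubspace K) where

    -- This is K + ℝy, written so that the element of `K` is computed from `x` and `t` instead of
    -- being a further witness.
    Adjoin : ℝ^ d → Pred (ℝ^ d) 0ℓ
    Adjoin y x = ∃[ t ] (λ i → x i + t * y i) ∈ K

    Adjoin-isSubspace : ∀ y → IsSubspace (Adjoin y)
    Adjoin-isSubspace y = record
      { respects = λ x≋x′ (t , ∈K) → t , respects K-sub (λ i → +-congʳ (x≋x′ i)) ∈K
      ; 0∈       = 0# , respects K-sub (λ i → solve 1 (λ y → :0 := :0 :+ :0 :* y) refl (y i)) (0∈ K-sub)
      ; +*∈      = λ {x} {x′} s (t , ∈K) (t′ , ∈K′) → t + s * t′ , respects K-sub
          (λ i → solve 6 (λ x t y s x′ t′ → x :+ t :* y :+ s :* (x′ :+ t′ :* y) := x :+ s :* x′ :+ (t :+ s :* t′) :* y)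
                   refl (x i) t (y i) s (x′ i) t′)
          (+*∈ K-sub s ∈K ∈K′)
      }

    -- The exchange step: one basis vector is traded for the combination y.
    removeAt-independent : ∀ (w : Vector (ℝ^ d) (suc a)) c {j} → ¬ (c j ≈ 0#) → IndependentModulo K w →
      IndependentModulo (Adjoin (linearCombination c w)) (removeAt w j)
    removeAt-independent w c {j} cj≉0 indep γ (t , ∈K) l = begin
      γ l                                       ≈⟨ solve 2 (λ x y → x := x :+ :0 :* y) refl _ (c (punchIn j l)) ⟩
      γ l + 0# * c (punchIn j l)                ≈⟨ +-congˡ (*-congʳ t≈0) ⟨
      γ l + t * c (punchIn j l)                 ≈⟨ +-congʳ (reflexive (insertAt-punchIn γ j 0# l)) ⟨
      e (punchIn j l)                           ≈⟨ e≈0 (punchIn j l) ⟩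
      0#                                        ∎
      where
      e : Vector Carrier (suc _)
      e l = insertAt γ j 0# l + t * c l

      e≈0 : ∀ l → e l ≈ 0#
      e≈0 = indep e (respects K-sub (λ i → sym (trans (linearCombination-+* (insertAt γ j 0#) c t w i)
              (+-congʳ (linearCombination-insertAt γ j w i)))) ∈K)

      t≈0 : t ≈ 0#
      t≈0 = *-zero-product cj≉0 (begin
        c j * t                       ≈⟨ *-comm _ _ ⟩
        t * c j                       ≈⟨ +-identityˡ _ ⟨
        0# + t * c j                  ≈⟨ +-congʳ (reflexive (insertAt-lookup γ j 0#)) ⟨
        e j                           ≈⟨ e≈0 j ⟩
        0#                            ∎)

    -- The way back from the exchange. A relation modulo `K` is one modulo K + ℝy for the vectors
    -- `x`, so their coefficients vanish. What remains is a multiple of y in `K`, and independence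
    -- of `w` together with the nonzero `c j` forces that multiple to be 0.
    ∷-independent : ∀ (w : Vector (ℝ^ d) a) c {j} → ¬ (c j ≈ 0#) → IndependentModulo K w →
      {x : Vector (ℝ^ d) b} → IndependentModulo (Adjoin (linearCombination c w)) x →
      IndependentModulo K (linearCombination c w ∷ x)
    ∷-independent w c {j} cj≉0 indep {x} indep′ γ ∈K = all≈0
      where
      tail≈0 : ∀ l → γ (suc l) ≈ 0#
      tail≈0 = indep′ (tail γ) (γ zero , respects K-sub (λ i → +-comm _ _) ∈K)

      scaled : linearCombination γ (linearCombination c w ∷ x) ≋ linearCombination (λ l → γ zero * c l) w
      scaled i = begin
        γ zero * linearCombination c w i + linearCombination (tail γ) x i   ≈⟨ +-congˡ (linearCombination-zero x tail≈0 i) ⟩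
        γ zero * linearCombination c w i + 0#                               ≈⟨ +-identityʳ _ ⟩
        γ zero * linearCombination c w i                                    ≈⟨ *-distribˡ-sum (γ zero) (λ l → c l * w l i) ⟩
        sum (λ l → γ zero * (c l * w l i))                                  ≈⟨ sum-cong-≋ (λ l → *-assoc (γ zero) (c l) (w l i)) ⟨
        linearCombination (λ l → γ zero * c l) w i                          ∎

      all≈0 : ∀ l → γ l ≈ 0#
      all≈0 zero    = *-zero-product cj≉0 (trans (*-comm _ _) (indep (λ l → γ zero * c l) (respects K-sub scaled ∈K) j))
      all≈0 (suc l) = tail≈0 l

  -- Vectors independent modulo `K` that outnumber the codimension of `L` have a nontrivial
  -- combination y in `L`. Adjoining y to `K` costs one of the vectors, and the induction on `b`
  -- continues modulo K + ℝy. In dimensions: dim L / (K ∩ L) is at least codim K - codim L.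
  independent-within : {K L : Pred (ℝ^ d) 0ℓ} → IsSubspace K → IsSubspace L →
    ¬ Codim≥ L (suc a) → ∀ b → Codim≥ K (b ℕ.+ a) → ∃[ x ] (∀ j → x j ∈ L) × IndependentModulo {a = b} K x
  independent-within K L codim zero    _           = [] , (λ ()) , λ c _ ()
  independent-within {L = L} K-sub L-sub codim (suc b) (w , indep)
    with c , y∈L , j , cj≉0 ← dependence L w (λ indep′ →
           codim (Codim≥-+ L-sub b (subst (Codim≥ L) (≡.sym (ℕ.+-suc b _)) (w , indep′)))) =
    let y = linearCombination c w
        x , x∈L , indep′ = independent-within (Adjoin-isSubspace K-sub y) L-sub codim b
          (removeAt w j , removeAt-independent K-sub w c cj≉0 indep)
    in y ∷ x , (λ { zero → y∈L ; (suc l) → x∈L l }) , ∷-independent K-sub w c cj≉0 indep indep′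

  -- If a combination of `v ++ x` lies in `K`, it lies in `L`, and so does its `x` part; hence the
  -- `v` coefficients vanish, and then the others by independence modulo `K`. Together with
  -- `independent-within` this yields submodularity.
  Codim≥-append : {K L : Pred (ℝ^ d) 0ℓ} → IsSubspace K → IsSubspace L → K ⊆ L → Codim≥ L a →
    {x : Vector (ℝ^ d) b} → (∀ j → x j ∈ L) → IndependentModulo K x → Codim≥ K (a ℕ.+ b)
  Codim≥-append {a = a} {b} {K = K} K-sub L-sub K⊆L (v , indep-v) {x} x∈L indep-x = v ++ x , independent
    where
    independent : IndependentModulo K (v ++ x)
    independent c ∈K = λ j → trans (reflexive (cong c (≡.sym (join-splitAt a b j)))) (cases (splitAt a j))
      where
      left : ∀ j → c (j ↑ˡ b) ≈ 0#
      left = indep-v (c ∘ (_↑ˡ b)) (respects L-sub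
        (λ i → trans (+-congʳ (linearCombination-++ c v x i))
          (solve 2 (λ p q → p :+ q :+ :- :1 :* q := p) refl _ _))
        (+*∈ L-sub (- 1#) (K⊆L ∈K) (combination∈ L-sub {c = c ∘ (a ↑ʳ_)} x∈L)))

      right : ∀ j → c (a ↑ʳ j) ≈ 0#
      right = indep-x (c ∘ (a ↑ʳ_)) (respects K-sub
        (λ i → trans (linearCombination-++ c v x i) (trans (+-congʳ (linearCombination-zero v left i)) (+-identityˡ _))) ∈K)

      cases : ∀ s → c (join a b s) ≈ 0#
      cases (inj₁ j) = left j
      cases (inj₂ j) = right j

  -- Submodularity of codimension.
  Codim≥-∩ : {X Y Z : Pred (ℝ^ d) 0ℓ} → IsSubspace X → IsSubspace Y → IsSubspace Z → X ⊆ Z → Y ⊆ Z →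
    ¬ Codim≥ X (suc p) → Codim≥ Z r → ¬ Codim≥ Y (r ℕ.+ suc b) → ¬ Codim≥ (X ∩ Y) (suc b ℕ.+ p)
  Codim≥-∩ X Y Z X⊆Z Y⊆Z codim-X codim-Z codim-Y codim-∩
    with x , x∈X , indep ← independent-within (∩-isSubspace X Y) X codim-X (suc _) codim-∩ =
    codim-Y (Codim≥-append Y Z Y⊆Z codim-Z (X⊆Z ∘ x∈X) λ c c∈Y → indep c (combination∈ X {c = c} x∈X , c∈Y))

  ¬Codim≥-U : ¬ Codim≥ {d} U 1
  ¬Codim≥-U (v , indep) = 0≉1 (sym (indep (λ _ → 1#) tt zero))

  -- The combination of the two vectors with coefficients `β` and `- α` has coordinate `i` equal to
  -- 0, so `α` vanishes; then the first vector itself lies in the hyperplane.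
  ¬Codim≥-hyperplane : ∀ (i : Fin d) → ¬ Codim≥ (λ x → x i ≈ 0#) 2
  ¬Codim≥-hyperplane i (v , indep) = 0≉1 (sym (indep (1# ∷ 0# ∷ []) (begin
      1# * α + (0# * β + 0#)  ≈⟨ +-congʳ (*-congˡ α≈0) ⟩
      1# * 0# + (0# * β + 0#) ≈⟨ solve 1 (λ y → :1 :* :0 :+ (:0 :* y :+ :0) := :0) refl β ⟩
      0#                      ∎) zero))
    where
    α = v zero i
    β = v (suc zero) i
    α≈0 : α ≈ 0#
    α≈0 = begin
      α                    ≈⟨ solve 1 (λ x → x := :0 :- :- x) refl α ⟩
      0# - - α             ≈⟨ +-congˡ (-‿cong (indep (β ∷ - α ∷ [])
                                (solve 2 (λ x y → y :* x :+ (:- x :* y :+ :0) := :0) refl α β) (suc zero))) ⟩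
      0# - 0#              ≈⟨ -‿inverseʳ 0# ⟩
      0#                   ∎

  -- `Null` is the intersection of the d coordinate hyperplanes, and by submodularity each of them
  -- adds at most 1 to the codimension. The induction runs over lists `φ` of coordinates because the
  -- ambient dimension has to stay fixed.
  ¬Codim≥-Null : ¬ Codim≥ {d} Null (suc d)
  ¬Codim≥-Null {d} = coordinates (λ i → i)
    where
    Vanishing : ∀ {n} → (Fin n → Fin d) → Pred (ℝ^ d) 0ℓ
    Vanishing φ x = ∀ j → x (φ j) ≈ 0#

    coordinates : ∀ {n} (φ : Fin n → Fin d) → ¬ Codim≥ (Vanishing φ) (suc n)
    coordinates {zero}  φ codim = ¬Codim≥-U (Codim≥-mono U (Vanishing φ) (λ _ ()) codim)
    coordinates {suc n} φ codim = Codim≥-∩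
      (⋂-isSubspace λ j → hyperplane (φ (suc j))) (hyperplane (φ zero)) U-isSubspace _ _
      (coordinates (φ ∘ suc)) ([] , λ _ _ ()) (¬Codim≥-hyperplane (φ zero))
      (Codim≥-mono (Vanishing (φ ∘ suc) ∩ λ x → x (φ zero) ≈ 0#) (Vanishing φ)
        (λ (tail≈0 , head≈0) → λ { zero → head≈0 ; (suc j) → tail≈0 j }) codim)
      where
      hyperplane : ∀ i → IsSubspace (λ x → x i ≈ 0#)
      hyperplane i = record
        { respects = λ x≋y x≈0 → trans (sym (x≋y i)) x≈0
        ; 0∈       = refl
        ; +*∈      = λ t x≈0 y≈0 → trans (+-cong x≈0 (*-congˡ y≈0)) (solve 1 (λ t → :0 :+ t :* :0 := :0) refl t)
        }

  Codim≥-Null : Codim≥ {d} Null d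
  Codim≥-Null = unitVector , λ c c≋0 j → trans (sym (unit c j)) (c≋0 j)
    where
    symmetric : ∀ {n} (i j : Fin n) → unitVector i j ≡ unitVector j i
    symmetric i j with i ≟ j
    ... | yes ≡.refl = ≡.sym (cong (if_then 1# else 0#) (dec-true (i ≟ i) ≡.refl))
    ... | no i≢j     = ≡.sym (cong (if_then 1# else 0#) (dec-false (j ≟ i) (i≢j ∘ ≡.sym)))

    unit : ∀ c j → linearCombination c unitVector j ≈ c j
    unit c j = trans (sum-cong-≋ λ i → trans (*-comm _ _) (*-congʳ (reflexive (symmetric i j)))) (sum-unitVector c j)

-- Sizes and enumerations of finite subsets.

module FiniteSubsets where
  open Vec using ([]; _∷_)

  -- Here `b` counts the elements of `I` outside `J`. Naming it gives the modular law without
  -- subtraction, in the shape that `Codim≥-∩` takes.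
  ∣∪∣+∣∩∣ : ∀ {n} (I J : Subset n) →
    ∃[ b ] ∣ I ∣ ≡ ∣ I Subset.∩ J ∣ ℕ.+ b × ∣ I Subset.∪ J ∣ ≡ b ℕ.+ ∣ J ∣
  ∣∪∣+∣∩∣ []            []            = 0 , ≡.refl , ≡.refl
  ∣∪∣+∣∩∣ (outside ∷ I) (outside ∷ J) = ∣∪∣+∣∩∣ I J
  ∣∪∣+∣∩∣ (inside ∷ I)  (inside ∷ J)  with b , p , q ← ∣∪∣+∣∩∣ I J =
    b , cong suc p , ≡.trans (cong suc q) (≡.sym (ℕ.+-suc b _))
  ∣∪∣+∣∩∣ (outside ∷ I) (inside ∷ J)  with b , p , q ← ∣∪∣+∣∩∣ I J =
    b , p , ≡.trans (cong suc q) (≡.sym (ℕ.+-suc b _))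
  ∣∪∣+∣∩∣ (inside ∷ I)  (outside ∷ J) with b , p , q ← ∣∪∣+∣∩∣ I J =
    suc b , ≡.trans (cong suc p) (≡.sym (ℕ.+-suc _ b)) , cong suc q

  enumerate : ∀ {n} (I : Subset n) → ∃[ e ] Injective _≡_ _≡_ e × (∀ (a : Fin ∣ I ∣) → e a Subset.∈ I)
  enumerate []            = (λ ()) , (λ { {()} }) , λ ()
  enumerate (outside ∷ I) with e , e-inj , e∈I ← enumerate I =
    suc ∘ e , e-inj ∘ suc-injective , there ∘ e∈I
  enumerate {suc n} (inside ∷ I)  with e , e-inj , e∈I ← enumerate I =
    e′ , inj , ∈I
    where
    e′ : Fin (suc ∣ I ∣) → Fin (suc n)
    e′ zero    = zero
    e′ (suc a) = suc (e a)
    inj : Injective _≡_ _≡_ e′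
    inj {zero}  {zero}  _  = ≡.refl
    inj {suc a} {suc b} eq = cong suc (e-inj (suc-injective eq))
    ∈I : ∀ a → e′ a Subset.∈ (inside ∷ I)
    ∈I zero    = here
    ∈I (suc a) = there (e∈I a)

-- Rado's theorem for families of subspaces.

module Transversals (em : ExcludedMiddle 0ℓ) (ℝ : CompleteOrderedField) where
  open EuclideanSpace ℝ
  open RankModulo em ℝ
  open FiniteSubsets
  open Vec using ([]; _∷_)

  private variable
    d m n q : ℕ

  Meet : (Fin n → Pred (ℝ^ d) 0ℓ) → Subset n → Pred (ℝ^ d) 0ℓ
  Meet L I x = ∀ i → i Subset.∈ I → x ∈ L i

  Meet-isSubspace : {L : Fin n → Pred (ℝ^ d) 0ℓ} → (∀ i → IsSubspace (L i)) → ∀ I → IsSubspace (Meet L I)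
  Meet-isSubspace L I = ⋂-isSubspace λ i → ⋂-isSubspace λ _ → L i

  Meet₂ : Vector (Pred (ℝ^ d) 0ℓ) q → Vector (Pred (ℝ^ d) 0ℓ) m → Subset q → Subset m → Pred (ℝ^ d) 0ℓ
  Meet₂ Q M I J = Meet Q I ∩ Meet M J

  -- Rado's condition for the combined family: Q holds the subspaces already selected,
  -- M the total subspaces of the families still to be treated.
  Rado : Vector (Pred (ℝ^ d) 0ℓ) q → Vector (Pred (ℝ^ d) 0ℓ) m → Set
  Rado Q M = ∀ I J → Codim≥ (Meet₂ Q M I J) (∣ I ∣ ℕ.+ ∣ J ∣)

  module _ {Q : Vector (Pred (ℝ^ d) 0ℓ) q} (Q-sub : ∀ i → IsSubspace (Q i))
           {M : Vector (Pred (ℝ^ d) 0ℓ) m} (M-sub : ∀ i → IsSubspace (M i)) where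

    Meet₂-isSubspace : ∀ I J → IsSubspace (Meet₂ Q M I J)
    Meet₂-isSubspace I J = ∩-isSubspace (Meet-isSubspace Q-sub I) (Meet-isSubspace M-sub J)

    -- Adding N to Q and M violates Rado's condition.
    Violates : Pred (ℝ^ d) 0ℓ → Set
    Violates N = ∃[ I ] ∃[ J ] ¬ Codim≥ (N ∩ Meet₂ Q M I J) (suc (∣ I ∣ ℕ.+ ∣ J ∣))

    -- Uncrossing: if two subspaces violate the condition at (I, J) and at (I′, J′), then their
    -- intersection violates it at the unions. Submodularity gives this because Rado's condition
    -- bounds the codimension from below at (I ∩ I′, J ∩ J′). The empty intersection is the whole
    -- space, which violates it at the empty sets.
    Violates-⋂ : Rado Q M → (N : Vector (Pred (ℝ^ d) 0ℓ) n) → (∀ j → IsSubspace (N j)) →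
      (∀ j → Violates (N j)) → Violates (⋂ (Fin n) N)
    Violates-⋂ {n = zero} rado N N-sub violates = Subset.⊥ , Subset.⊥ , λ codim → ¬Codim≥-U (Codim≥-mono U N⊥⊥
      (λ _ → (λ ()) , (λ i i∈⊥ → contradiction i∈⊥ ∉⊥) , λ i i∈⊥ → contradiction i∈⊥ ∉⊥)
      (subst (Codim≥ N⊥⊥) (cong suc (cong₂ ℕ._+_ (∣⊥∣≡0 q) (∣⊥∣≡0 m))) codim))
      where N⊥⊥ = ⋂ (Fin 0) N ∩ Meet₂ Q M Subset.⊥ Subset.⊥
    Violates-⋂ {n = suc n} rado N N-sub violates
      with I , J , violates₀ ← violates zero
         | I′ , J′ , violates′ ← Violates-⋂ rado (N ∘ suc) (N-sub ∘ suc) (violates ∘ suc)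
      with a , I-size , I∪I′-size ← ∣∪∣+∣∩∣ I I′
         | b , J-size , J∪J′-size ← ∣∪∣+∣∩∣ J J′ =
      I Subset.∪ I′ , J Subset.∪ J′ , λ codim →
        Codim≥-∩ {r = ∣ I Subset.∩ I′ ∣ ℕ.+ ∣ J Subset.∩ J′ ∣} {b = a ℕ.+ b}
                 (∩-isSubspace (⋂-isSubspace (N-sub ∘ suc)) (Meet₂-isSubspace I′ J′))
                 (∩-isSubspace (N-sub zero) (Meet₂-isSubspace I J))
                 (Meet₂-isSubspace (I Subset.∩ I′) (J Subset.∩ J′))
                 (λ (_ , x∈Q , x∈M) → (λ i → x∈Q i ∘ p∩q⊆q I I′) , λ i → x∈M i ∘ p∩q⊆q J J′)
                 (λ (_ , x∈Q , x∈M) → (λ i → x∈Q i ∘ p∩q⊆p I I′) , λ i → x∈M i ∘ p∩q⊆p J J′)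
                 violates′
                 (rado (I Subset.∩ I′) (J Subset.∩ J′))
                 (violates₀ ∘ subst (Codim≥ (N zero ∩ Meet₂ Q M I J)) (sizes-Y ∣ I Subset.∩ I′ ∣ ∣ J Subset.∩ J′ ∣ a b I-size J-size))
                 (Codim≥-mono ((⋂ (Fin n) (N ∘ suc) ∩ Meet₂ Q M I′ J′) ∩ (N zero ∩ Meet₂ Q M I J)) N∪∪
                   (λ ((x∈N , x∈Q′ , x∈M′) , (x∈N₀ , x∈Q , x∈M)) →
                     (λ { zero → x∈N₀ ; (suc j) → x∈N j }) ,
                     (λ i → [ x∈Q i , x∈Q′ i ]′ ∘ x∈p∪q⁻ I I′) ,
                     (λ i → [ x∈M i , x∈M′ i ]′ ∘ x∈p∪q⁻ J J′))
                   (subst (Codim≥ N∪∪) (sizes-∪ ∣ I′ ∣ ∣ J′ ∣ a b I∪I′-size J∪J′-size) codim))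
      where
      N∪∪ = ⋂ (Fin (suc n)) N ∩ Meet₂ Q M (I Subset.∪ I′) (J Subset.∪ J′)
      open +-*-Solver
      sizes-Y : ∀ r s a b {i j} → i ≡ r ℕ.+ a → j ≡ s ℕ.+ b → (r ℕ.+ s) ℕ.+ suc (a ℕ.+ b) ≡ suc (i ℕ.+ j)
      sizes-Y r s a b ≡.refl ≡.refl = solve 4 (λ r s a b →
        (r :+ s) :+ (con 1 :+ (a :+ b)) := con 1 :+ ((r :+ a) :+ (s :+ b))) ≡.refl r s a b
      sizes-∪ : ∀ r s a b {i j} → i ≡ a ℕ.+ r → j ≡ b ℕ.+ s → suc (i ℕ.+ j) ≡ suc (a ℕ.+ b) ℕ.+ (r ℕ.+ s)
      sizes-∪ r s a b ≡.refl ≡.refl = solve 4 (λ r s a b →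
        con 1 :+ ((a :+ r) :+ (b :+ s)) := con 1 :+ (a :+ b) :+ (r :+ s)) ≡.refl r s a b

  -- If no `N j` could be selected, each would violate the condition, hence so would their
  -- intersection. As that lies in `M zero`, Rado's condition would fail at a set containing the
  -- first family.
  select : {Q : Vector (Pred (ℝ^ d) 0ℓ) q} → (∀ i → IsSubspace (Q i)) →
    {M : Vector (Pred (ℝ^ d) 0ℓ) (suc m)} → (∀ i → IsSubspace (M i)) → Rado Q M →
    (N : Vector (Pred (ℝ^ d) 0ℓ) n) → (∀ j → IsSubspace (N j)) → ⋂ (Fin n) N ⊆ M zero →
    ∃[ j ] Rado (N j Vector.∷ Q) (M ∘ suc)
  select {Q = Q} Q-sub {M} M-sub rado N N-sub ⋂N⊆M₀ = decidable-stable em λ none →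
    let I , J , violates = Violates-⋂ Q-sub (M-sub ∘ suc) rado-tail N N-sub λ j → decidable-stable em λ ok →
          none (j , λ where
            (outside ∷ I) J → Codim≥-mono (Meet₂ (N j Vector.∷ Q) (M ∘ suc) (outside ∷ I) J) (Meet₂ Q (M ∘ suc) I J)
              (λ (x∈Q , x∈M) → (λ i i∈I → x∈Q (suc i) (there i∈I)) , x∈M) (rado-tail I J)
            (inside ∷ I)  J → decidable-stable em λ ¬codim → ok (I , J , ¬codim ∘
              Codim≥-mono (Meet₂ (N j Vector.∷ Q) (M ∘ suc) (inside ∷ I) J) (N j ∩ Meet₂ Q (M ∘ suc) I J)
              (λ (x∈Q , x∈M) → x∈Q zero here , (λ i i∈I → x∈Q (suc i) (there i∈I)) , x∈M)))
    in violates (Codim≥-mono (⋂ (Fin _) N ∩ Meet₂ Q (M ∘ suc) I J) (Meet₂ Q M I (inside ∷ J))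
         (λ (x∈N , x∈Q , x∈M) → x∈Q , λ { zero _ → ⋂N⊆M₀ x∈N ; (suc i) (there i∈J) → x∈M i i∈J })
         (subst (Codim≥ (Meet₂ Q M I (inside ∷ J))) (ℕ.+-suc ∣ I ∣ ∣ J ∣) (rado I (inside ∷ J))))
    where
    rado-tail : Rado Q (M ∘ suc)
    rado-tail I J = Codim≥-mono (Meet₂ Q (M ∘ suc) I J) (Meet₂ Q M I (outside ∷ J))
      (λ (x∈Q , x∈M) → x∈Q , λ { (suc i) (there i∈J) → x∈M i i∈J }) (rado I (outside ∷ J))

  -- Each step moves one subspace of the first remaining family into `Q`. When no family remains,
  -- Rado's condition at the full index set of `Q` is the claim.
  transversal₂ : {Q : Vector (Pred (ℝ^ d) 0ℓ) q} → (∀ i → IsSubspace (Q i)) →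
    ∀ m {n : Fin m → ℕ} (L : ∀ i → Vector (Pred (ℝ^ d) 0ℓ) (n i)) → (∀ i j → IsSubspace (L i j)) →
    Rado Q (λ i → ⋂ (Fin (n i)) (L i)) →
    Σ[ σ ∈ (∀ i → Fin (n i)) ] Codim≥ (⋂ (Fin q) Q ∩ ⋂ (Fin m) λ i → L i (σ i)) (q ℕ.+ m)
  transversal₂ {q = q} {Q} Q-sub zero {n} L L-sub rado = σ₀ ,
    Codim≥-mono (⋂ (Fin q) Q ∩ ⋂ (Fin 0) λ i → L i (σ₀ i)) QM (λ (x∈Q , _) → (λ i _ → x∈Q i) , λ _ ())
      (subst (λ s → Codim≥ QM (s ℕ.+ 0)) (∣⊤∣≡n q) (rado Subset.⊤ []))
    where
    QM = Meet₂ Q (λ i → ⋂ (Fin (n i)) (L i)) Subset.⊤ []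
    σ₀ : ∀ i → Fin (n i)
    σ₀ ()
  transversal₂ {q = q} {Q} Q-sub (suc m) {n} L L-sub rado
    with j , rado′ ← select Q-sub (λ i → ⋂-isSubspace (L-sub i)) rado (L zero) (L-sub zero) (λ x∈ → x∈)
    with σ , codim ← transversal₂ {Q = L zero j Vector.∷ Q} (λ { zero → L-sub zero j ; (suc i) → Q-sub i })
                       m (L ∘ suc) (λ i → L-sub (suc i)) rado′ =
    σ′ , Codim≥-mono (⋂ (Fin q) Q ∩ ⋂ (Fin (suc m)) λ i → L i (σ′ i)) QL
      (λ (x∈Q , x∈L) → (λ { zero → x∈L zero ; (suc i) → x∈Q i }) , x∈L ∘ suc)
      (subst (Codim≥ QL) (≡.sym (ℕ.+-suc q m)) codim)
    where
    QL = ⋂ (Fin (suc q)) (L zero j Vector.∷ Q) ∩ ⋂ (Fin m) λ i → L (suc i) (σ i)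
    σ′ : ∀ i → Fin (n i)
    σ′ zero    = j
    σ′ (suc i) = σ i

  transversal : ∀ {m} {n : Fin m → ℕ} (L : ∀ i → Vector (Pred (ℝ^ d) 0ℓ) (n i)) → (∀ i j → IsSubspace (L i j)) →
    (∀ I → Codim≥ (Meet (λ i → ⋂ (Fin (n i)) (L i)) I) ∣ I ∣) →
    Σ[ σ ∈ (∀ i → Fin (n i)) ] Codim≥ (⋂ (Fin m) λ i → L i (σ i)) m
  transversal {m = m} {n} L L-sub rado =
    let σ , codim = transversal₂ {Q = []ᶠ} (λ ()) m L L-sub
                      λ { [] J → Codim≥-mono (Meet₂ []ᶠ ⋂L [] J) (Meet ⋂L J) proj₂ (rado J) }
    in σ , Codim≥-mono (⋂ (Fin m) λ i → L i (σ i)) (⋂ (Fin 0) []ᶠ ∩ ⋂ (Fin m) λ i → L i (σ i))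
             (λ x∈L → (λ ()) , x∈L) codim
    where
    []ᶠ : Vector (Pred (ℝ^ _) 0ℓ) 0
    []ᶠ = Vector.[]
    ⋂L = λ i → ⋂ (Fin (n i)) (L i)

-- Barycenters, and Radon's theorem modulo a subspace.

module ConvexSets (em : ExcludedMiddle 0ℓ) (ℝ : CompleteOrderedField) where
  open CompleteOrderedField ℝ hiding (zero)
  open Vector using (_∷_)
  open EuclideanSpace ℝ
  open OrderedField em ℝ
  open RankModulo em ℝ
  open VectorEquality setoid using (_≋_)
  open import Algebra.Properties.Semiring.Sum semiring
  open import Relation.Binary.Reasoning.Setoid setoid

  private variable
    n d u : ℕ

  Respects : Pred (ℝ^ d) 0ℓ → Set
  Respects S = ∀ {x y} → x ≋ y → x ∈ S → y ∈ S

  sum-mono-≤ : {f g : Vector Carrier n} → (∀ i → f i ≤ g i) → sum f ≤ sum g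
  sum-mono-≤ {zero}  f≤g = ≤-refl
  sum-mono-≤ {suc n} f≤g = +-mono-≤ (f≤g zero) (sum-mono-≤ (f≤g ∘ suc))

  sum-nonNegative : {f : Vector Carrier n} → (∀ i → 0# ≤ f i) → 0# ≤ sum f
  sum-nonNegative {zero}  0≤f = ≤-refl
  sum-nonNegative {suc n} 0≤f = +-nonNegative (0≤f zero) (sum-nonNegative (0≤f ∘ suc))

  term≤sum : {f : Vector Carrier n} → (∀ i → 0# ≤ f i) → ∀ i → f i ≤ sum f
  term≤sum {suc n} {f} 0≤f zero    = ≤-respˡ-≈ (+-identityʳ _) (+-mono-≤ ≤-refl (sum-nonNegative (0≤f ∘ suc)))
  term≤sum {suc n} {f} 0≤f (suc i) = ≤-respˡ-≈ (+-identityˡ _) (+-mono-≤ (0≤f zero) (term≤sum (0≤f ∘ suc) i))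

  sum≤0⇒≈0 : {f : Vector Carrier n} → (∀ i → 0# ≤ f i) → sum f ≤ 0# → ∀ i → f i ≈ 0#
  sum≤0⇒≈0 0≤f sum≤0 i = antisym (≤-trans (term≤sum 0≤f i) sum≤0) (0≤f i)

  abstract
    -- Unnormalised weights keep division out of the statement. The first point is joined to the
    -- barycenter of the rest in the ratio of the weights; if the rest has total weight 0, all its
    -- weights vanish and the first point alone serves.
    barycenter : {S : Pred (ℝ^ d) 0ℓ} → Convex S → (w : Vector Carrier n) (q : Vector (ℝ^ d) n) →
      (∀ i → 0# ≤ w i) → (∀ i → q i ∈ S) → 0# < sum w →
      ∃[ y ] y ∈ S × (λ i → sum w * y i) ≋ linearCombination w q
    barycenter {n = zero}  convex w q 0≤w q∈S 0<w = contradiction refl (proj₂ 0<w)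
    barycenter {n = suc n} convex w q 0≤w q∈S 0<w with ≈? (sum (tail w)) 0#
    ... | yes tail≈0 = q zero , q∈S zero , λ i → begin
            (w zero + sum (tail w)) * q zero i      ≈⟨ *-congʳ (+-congˡ tail≈0) ⟩
            (w zero + 0#) * q zero i                ≈⟨ solve 2 (λ w q → (w :+ :0) :* q := w :* q :+ :0) refl _ _ ⟩
            w zero * q zero i + 0#                  ≈⟨ +-congˡ (linearCombination-zero (tail q)
                                                         (sum≤0⇒≈0 (0≤w ∘ suc) (≤-reflexive tail≈0)) i) ⟨
            linearCombination w q i                 ∎
    ... | no tail≉0
      with y , y∈S , rest ← barycenter convex (tail w) (tail q) (0≤w ∘ suc) (q∈S ∘ suc)
                              (sum-nonNegative (0≤w ∘ suc) , tail≉0 ∘ sym)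
      with s⁻¹ , 0<s⁻¹ , ss⁻¹≈1 ← positive-inverse 0<w =
        (λ i → (1# - r * s⁻¹) * q zero i + r * s⁻¹ * y i) ,
        convex (q zero) y (r * s⁻¹) (q∈S zero) y∈S
          (*-nonNegative (sum-nonNegative (0≤w ∘ suc)) (proj₁ 0<s⁻¹))
          (≤-by (w zero * s⁻¹)
            (trans (+-congʳ (sym ss⁻¹≈1)) (solve 3 (λ w r s → (w :+ r) :* s :- r :* s := w :* s) refl (w zero) r s⁻¹))
            (*-nonNegative (0≤w zero) (proj₁ 0<s⁻¹))) ,
        λ i → begin
          s * ((1# - r * s⁻¹) * q zero i + r * s⁻¹ * y i)
            ≈⟨ solve 5 (λ s r s⁻¹ q y → s :* ((:1 :- r :* s⁻¹) :* q :+ r :* s⁻¹ :* y) :=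
                          s :* q :- s :* s⁻¹ :* (r :* q) :+ s :* s⁻¹ :* (r :* y)) refl s r s⁻¹ (q zero i) (y i) ⟩
          s * q zero i - s * s⁻¹ * (r * q zero i) + s * s⁻¹ * (r * y i)
            ≈⟨ +-cong (+-congˡ (-‿cong (*-congʳ ss⁻¹≈1))) (*-congʳ ss⁻¹≈1) ⟩
          s * q zero i - 1# * (r * q zero i) + 1# * (r * y i)
            ≈⟨ solve 4 (λ w r q z → (w :+ r) :* q :- :1 :* (r :* q) :+ :1 :* z := w :* q :+ z) refl (w zero) r (q zero i) (r * y i) ⟩
          w zero * q zero i + r * y i
            ≈⟨ +-congˡ (rest i) ⟩
          linearCombination w q i ∎
      where
      r s : Carrier
      r = sum (tail w)
      s = sum w

  abstract
    signed-parts : ∀ x → ∃[ p ] ∃[ m ] 0# ≤ p × 0# ≤ m × x ≈ p - m × (p ≈ 0# ⊎ m ≈ 0#)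
    signed-parts x with total 0# x
    ... | inj₁ 0≤x = x , 0# , 0≤x , ≤-refl , solve 1 (λ x → x := x :- :0) refl x , inj₂ refl
    ... | inj₂ x≤0 = 0# , - x , ≤-refl , x≤0⇒0≤-x x≤0 , solve 1 (λ x → x := :0 :- :- x) refl x , inj₁ refl

  replace : Fin n → ℝ^ d → Vector (ℝ^ d) n → Vector (ℝ^ d) n
  replace b x q a = if does (a ≟ b) then x else q a

  replace∈ : (S : Pred (ℝ^ d) 0ℓ) (b : Fin n) (x : ℝ^ d) (q : Vector (ℝ^ d) n) →
    x ∈ S → (∀ a → a ≢ b → q a ∈ S) → ∀ a → replace b x q a ∈ S
  replace∈ S b x q x∈S q∈S a with a ≟ b
  ... | yes _  = x∈S
  ... | no a≢b = q∈S a a≢b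

  linearCombination-replace : (c : Vector Carrier n) (b : Fin n) (x : ℝ^ d) (q : Vector (ℝ^ d) n) →
    c b ≈ 0# → linearCombination c (replace b x q) ≋ linearCombination c q
  linearCombination-replace c b x q cb≈0 i = sum-cong-≋ term
    where
    term : ∀ a → c a * replace b x q a i ≈ c a * q a i
    term a with a ≟ b
    ... | yes ≡.refl = trans (*-congʳ cb≈0) (trans (zeroˡ _) (sym (trans (*-congʳ cb≈0) (zeroˡ _))))
    ... | no _       = refl

  -- The point omitting B is q₀, and q a is the point omitting S a.
  module _ {L B : Pred (ℝ^ d) 0ℓ} {S : Vector (Pred (ℝ^ d) 0ℓ) (suc u)} (L-sub : IsSubspace L)
           (B-convex : Convex B) (S-convex : ∀ a → Convex (S a)) (S-respects : ∀ a → Respects (S a))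
           (S-invariant : ∀ a x l → x ∈ S a → l ∈ L → (λ i → x i + l i) ∈ S a)
           (q : Vector (ℝ^ d) (suc u)) (q₀ : ℝ^ d)
           (q∈B : ∀ a → q a ∈ B) (q∈S : ∀ b a → a ≢ b → q a ∈ S b) (q₀∈S : ∀ b → q₀ ∈ S b) where

    private
      differences : Vector (ℝ^ d) (suc u)
      differences a i = q a i - q₀ i

    -- Give `q a` the weight `c a` and `q₀` the weight `- sum c`: the total is 0 and the weighted
    -- sum lies in `L`. As `0# ≤ sum c`, the point `q₀` goes to the negative side. The barycenter
    -- `z` of the positive side then involves only points of `B`, and modulo `L` it equals the
    -- barycenter of the negative side.
    radon-signed : ∀ c → linearCombination c differences ∈ L → 0# ≤ sum c → ∀ j → ¬ (c j ≈ 0#) →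
      ∃[ z ] z ∈ B × (∀ b → z ∈ S b)
    radon-signed c c∈L 0≤c j cj≉0 = z , z∈B , z∈S
      where
      parts = signed-parts ∘ c
      c⁺ c⁻ : Vector Carrier (suc u)
      c⁺ a = proj₁ (parts a)
      c⁻ a = proj₁ (proj₂ (parts a))
      0≤c⁺ : ∀ a → 0# ≤ c⁺ a
      0≤c⁺ a = proj₁ (proj₂ (proj₂ (parts a)))
      0≤c⁻ : ∀ a → 0# ≤ c⁻ a
      0≤c⁻ a = proj₁ (proj₂ (proj₂ (proj₂ (parts a))))
      c≈c⁺-c⁻ : ∀ a → c a ≈ c⁺ a - c⁻ a
      c≈c⁺-c⁻ a = proj₁ (proj₂ (proj₂ (proj₂ (proj₂ (parts a)))))

      c⁺≈c+c⁻ : ∀ a → c⁺ a ≈ c a + c⁻ a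
      c⁺≈c+c⁻ a = trans (solve 2 (λ p m → p := p :- m :+ m) refl (c⁺ a) (c⁻ a)) (+-congʳ (sym (c≈c⁺-c⁻ a)))

      P N : Carrier
      P = sum c⁺
      N = sum c⁻

      P≈c+N : P ≈ sum c + N
      P≈c+N = trans (sum-cong-≋ c⁺≈c+c⁻) (∑-distrib-+ c c⁻)

      0<P : 0# < P
      -- If `P` were at most 0, all `c⁺` would vanish; as `N` is at most `P`, so would all `c⁻`, and
      -- with them `c j`.
      0<P = ≰⇒> λ P≤0 → cj≉0 (trans (c≈c⁺-c⁻ j) (trans
        (+-cong (sum≤0⇒≈0 0≤c⁺ P≤0 j)
                (-‿cong (sum≤0⇒≈0 0≤c⁻ (≤-trans (≤-respʳ-≈ (sym P≈c+N)
                  (≤-respˡ-≈ (+-identityˡ N) (+-mono-≤ 0≤c ≤-refl))) P≤0) j)))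
        (-‿inverseʳ 0#)))

      z-spec = barycenter B-convex c⁺ q 0≤c⁺ q∈B 0<P
      z = proj₁ z-spec
      z∈B : z ∈ B
      z∈B = proj₁ (proj₂ z-spec)
      Pz : (λ i → P * z i) ≋ linearCombination c⁺ q
      Pz = proj₂ (proj₂ z-spec)

      P⁻¹-spec = positive-inverse 0<P
      P⁻¹ = proj₁ P⁻¹-spec
      PP⁻¹≈1 : P * P⁻¹ ≈ 1#
      PP⁻¹≈1 = proj₂ (proj₂ P⁻¹-spec)

      cancel : ∀ {x y} → P * x ≈ y → x ≈ P⁻¹ * y
      cancel {x} {y} Px≈y = begin
        x                  ≈⟨ *-identityˡ x ⟨
        1# * x             ≈⟨ *-congʳ PP⁻¹≈1 ⟨
        P * P⁻¹ * x        ≈⟨ solve 3 (λ p r x → p :* r :* x := r :* (p :* x)) refl P P⁻¹ x ⟩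
        P⁻¹ * (P * x)      ≈⟨ *-congˡ Px≈y ⟩
        P⁻¹ * y            ∎

      combination-differences : ∀ i → linearCombination c differences i ≈ linearCombination c q i - sum c * q₀ i
      combination-differences i = begin
        sum (λ a → c a * (q a i - q₀ i))                  ≈⟨ sum-cong-≋ (λ a → solve 3 (λ c q x → c :* (q :- x) := c :* q :+ c :* :- x) refl (c a) (q a i) (q₀ i)) ⟩
        sum (λ a → c a * q a i + c a * - q₀ i)            ≈⟨ ∑-distrib-+ (λ a → c a * q a i) (λ a → c a * - q₀ i) ⟩
        linearCombination c q i + sum (λ a → c a * - q₀ i) ≈⟨ +-congˡ (*-distribʳ-sum (- q₀ i) c) ⟨
        linearCombination c q i + sum c * - q₀ i          ≈⟨ solve 3 (λ l c x → l :+ c :* :- x := l :- c :* x) refl (linearCombination c q i) (sum c) (q₀ i) ⟩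
        linearCombination c q i - sum c * q₀ i            ∎

      combination-c⁺ : ∀ i → linearCombination c⁺ q i ≈ linearCombination c q i + linearCombination c⁻ q i
      combination-c⁺ i = trans (sum-cong-≋ λ a → trans (*-congʳ (c⁺≈c+c⁻ a)) (distribʳ (q a i) (c a) (c⁻ a))) (∑-distrib-+ (λ a → c a * q a i) (λ a → c⁻ a * q a i))

      z∈S : ∀ b → z ∈ S b
      z∈S b with proj₂ (proj₂ (proj₂ (proj₂ (proj₂ (parts b)))))
      -- The only point that may lie outside `S b` is `q b`. Here it has weight 0 on the positive
      -- side, so putting `q₀` in its place leaves `z` unchanged.
      ... | inj₁ c⁺b≈0
        with y , y∈S , Py ← barycenter (S-convex b) c⁺ (replace b q₀ q) 0≤c⁺ (replace∈ (S b) b q₀ q (q₀∈S b) (q∈S b)) 0<P =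
          S-respects b (λ i → trans (cancel (Py i)) (trans
            (*-congˡ (trans (linearCombination-replace c⁺ b q₀ q c⁺b≈0 i) (sym (Pz i)))) (sym (cancel refl)))) y∈S
      -- Here `q b` has weight 0 on the negative side, so the barycenter `y` of that side is in
      -- `S b`; it differs from `z` by an element of `L`, under which `S b` is invariant.
      ... | inj₂ c⁻b≈0
        with y , y∈S , Py ← barycenter (S-convex b) (sum c ∷ c⁻) (q₀ ∷ replace b q₀ q)
               (λ { zero → 0≤c ; (suc a) → 0≤c⁻ a })
               (λ { zero → q₀∈S b ; (suc a) → replace∈ (S b) b q₀ q (q₀∈S b) (q∈S b) a })
               (<-≤-trans 0<P (≤-reflexive P≈c+N)) =
          S-respects b moved (S-invariant b y _ y∈S (IsSubspace.+*∈ L-sub {λ _ → 0#} P⁻¹ (IsSubspace.0∈ L-sub) c∈L))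
        where
        Py′ : ∀ i → P * y i ≈ sum c * q₀ i + linearCombination c⁻ q i
        Py′ i = trans (*-congʳ P≈c+N) (trans (Py i) (+-congˡ (linearCombination-replace c⁻ b q₀ q c⁻b≈0 i)))

        moved : (λ i → y i + (0# + P⁻¹ * linearCombination c differences i)) ≋ z
        moved i = begin
          y i + (0# + P⁻¹ * linearCombination c differences i)
            ≈⟨ +-cong (cancel (Py′ i)) (+-congˡ (*-congˡ (combination-differences i))) ⟩
          P⁻¹ * (sum c * q₀ i + lc⁻) + (0# + P⁻¹ * (lc - sum c * q₀ i))
            ≈⟨ solve 4 (λ r s m l → r :* (s :+ m) :+ (:0 :+ r :* (l :- s)) := r :* (l :+ m)) refl P⁻¹ (sum c * q₀ i) lc⁻ lc ⟩
          P⁻¹ * (lc + lc⁻)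
            ≈⟨ *-congˡ (trans (sym (combination-c⁺ i)) (sym (Pz i))) ⟩
          P⁻¹ * (P * z i)
            ≈⟨ cancel refl ⟨
          z i ∎
          where
          lc  = linearCombination c q i
          lc⁻ = linearCombination c⁻ q i

    radon : ¬ Codim≥ L (suc u) → ∃[ z ] z ∈ B × (∀ b → z ∈ S b)
    radon codim with c , c∈L , j , cj≉0 ← dependence L differences (λ indep → codim (differences , indep))
      with total 0# (sum c)
    ... | inj₁ 0≤c = radon-signed c c∈L 0≤c j cj≉0
    -- Negating the relation makes its sum nonnegative. The form `0# + - 1# * c a` matches the
    -- closure rule `+*∈` of subspaces.
    ... | inj₂ c≤0 = radon-signed (λ a → 0# + - 1# * c a)
          (IsSubspace.respects L-sub (λ i → sym (negated i)) (IsSubspace.+*∈ L-sub {λ _ → 0#} (- 1#) (IsSubspace.0∈ L-sub) c∈L))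
          (≤-respʳ-≈ (sym sum-negated) (x≤0⇒0≤-x c≤0)) j
          λ -cj≈0 → cj≉0 (trans (solve 1 (λ x → x := :- (:0 :+ :- :1 :* x)) refl (c j)) (trans (-‿cong -cj≈0)
            (solve 0 (:- :0 := :0) refl)))
      where
      sum-negated : sum (λ a → 0# + - 1# * c a) ≈ - sum c
      sum-negated = begin
        sum (λ a → 0# + - 1# * c a)  ≈⟨ sum-cong-≋ (λ a → +-identityˡ (- 1# * c a)) ⟩
        sum (λ a → - 1# * c a)       ≈⟨ *-distribˡ-sum (- 1#) c ⟨
        - 1# * sum c                 ≈⟨ solve 1 (λ x → :- :1 :* x := :- x) refl (sum c) ⟩
        - sum c                      ∎
      negated : linearCombination (λ a → 0# + - 1# * c a) differences ≋ λ i → 0# + - 1# * linearCombination c differences i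
      negated i = trans (linearCombination-+* (λ _ → 0#) c (- 1#) differences i)
                    (+-congʳ (linearCombination-zero differences (λ _ → refl) i))

-- Nearest points to the origin in closed convex sets.

module NearestPoints (em : ExcludedMiddle 0ℓ) (ℝ : CompleteOrderedField) where
  open CompleteOrderedField ℝ hiding (zero)
  open EuclideanSpace ℝ
  open OrderedField em ℝ
  open RankModulo em ℝ
  open ConvexSets em ℝ
  open VectorEquality setoid using (_≋_)
  open import Algebra.Properties.Semiring.Sum semiring
  open import Relation.Binary.Reasoning.Setoid setoid

  private variable
    n d u : ℕ

  x+x-nonNegative⇒ : ∀ {x} → 0# ≤ x + x → 0# ≤ x
  x+x-nonNegative⇒ {x} 0≤x+x with total 0# x
  ... | inj₁ 0≤x = 0≤x
  ... | inj₂ x≤0 = ≤-trans 0≤x+x (≤-respʳ-≈ (+-identityʳ x) (+-mono-≤ ≤-refl x≤0))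

  square≤0⇒≈0 : ∀ {x} → x * x ≤ 0# → x ≈ 0#
  square≤0⇒≈0 {x} x²≤0 = decidable-stable (≈? x 0#) λ x≉0 →
    x≉0 (*-zero-product x≉0 (antisym x²≤0 (square-nonNegative x)))

  2# : Carrier
  2# = 1# + 1#

  0<2 : 0# < 2#
  0<2 = +-positiveˡ 0<1 0≤1

  :2 : ∀ {n} → Polynomial n
  :2 = con (+ 2)

  norm² : ℝ^ d → Carrier
  norm² x = sum (λ i → x i * x i)

  ball-convex : ∀ ρ → Convex {d} (λ x → norm² x ≤ ρ)
  ball-convex ρ x y t x∈ y∈ 0≤t t≤1 = ≤-trans
    (sum-mono-≤ λ i → ≤-by (t * (1# - t) * ((x i - y i) * (x i - y i)))
      (solve 3 (λ x y t → (:1 :- t) :* (x :* x) :+ t :* (y :* y) :- ((:1 :- t) :* x :+ t :* y) :* ((:1 :- t) :* x :+ t :* y)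
                  := t :* (:1 :- t) :* ((x :- y) :* (x :- y))) refl (x i) (y i) t)
      (*-nonNegative (*-nonNegative 0≤t (x≤y⇒0≤y-x t≤1)) (square-nonNegative _)))
    (≤-respˡ-≈ (sym sums) (≤-respʳ-≈ (solve 2 (λ r t → (:1 :- t) :* r :+ t :* r := r) refl ρ t)
      (+-mono-≤ (*-monoˡ-≤ (x≤y⇒0≤y-x t≤1) x∈) (*-monoˡ-≤ 0≤t y∈))))
    where
    sums : sum (λ i → (1# - t) * (x i * x i) + t * (y i * y i)) ≈ (1# - t) * norm² x + t * norm² y
    sums = trans (sum-+* (λ i → (1# - t) * (x i * x i)) (λ i → y i * y i) t) (+-congʳ (sym (*-distribˡ-sum (1# - t) (λ i → x i * x i))))

  half-spec = positive-inverse 0<2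
  half = proj₁ half-spec

  2half≈1 : 2# * half ≈ 1#
  2half≈1 = proj₂ (proj₂ half-spec)

  midpoint : ℝ^ d → ℝ^ d → ℝ^ d
  midpoint x y i = (1# - half) * x i + half * y i

  parallelogram : (x y : ℝ^ d) → distance² x y + 2# * 2# * norm² (midpoint x y) ≈ 2# * (norm² x + 1# * norm² y)
  parallelogram x y = begin
    distance² x y + 2# * 2# * norm² (midpoint x y)
      ≈⟨ sum-+* (λ i → (x i - y i) * (x i - y i)) (λ i → midpoint x y i * midpoint x y i) (2# * 2#) ⟨
    sum (λ i → (x i - y i) * (x i - y i) + 2# * 2# * (midpoint x y i * midpoint x y i))
      ≈⟨ sum-cong-≋ (λ i → pointwise (x i) (y i)) ⟩
    sum (λ i → 2# * (x i * x i + 1# * (y i * y i)))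
      ≈⟨ *-distribˡ-sum 2# (λ i → x i * x i + 1# * (y i * y i)) ⟨
    2# * sum (λ i → x i * x i + 1# * (y i * y i))
      ≈⟨ *-congˡ (sum-+* (λ i → x i * x i) (λ i → y i * y i) 1#) ⟩
    2# * (norm² x + 1# * norm² y) ∎
    where
    pointwise : ∀ x y → let m = (1# - half) * x + half * y in
      (x - y) * (x - y) + 2# * 2# * (m * m) ≈ 2# * (x * x + 1# * (y * y))
    pointwise x y = begin
      -- To the solver `half` is a free variable. So twice the midpoint is first expressed through
      -- `2# * half`, which is then replaced by `1#`.
      (x - y) * (x - y) + 2# * 2# * (m * m)
        ≈⟨ solve 3 (λ x y h → let m = (:1 :- h) :* x :+ h :* y; t = (:2 :- :2 :* h) :* x :+ :2 :* h :* y in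
             (x :- y) :* (x :- y) :+ :2 :* :2 :* (m :* m) := (x :- y) :* (x :- y) :+ t :* t) refl x y half ⟩
      (x - y) * (x - y) + s (2# * half) * s (2# * half)
        ≈⟨ +-congˡ (*-cong (s-cong 2half≈1) (s-cong 2half≈1)) ⟩
      (x - y) * (x - y) + s 1# * s 1#
        ≈⟨ solve 2 (λ x y → let s = (:2 :- :1) :* x :+ :1 :* y in
             (x :- y) :* (x :- y) :+ s :* s := :2 :* (x :* x :+ :1 :* (y :* y))) refl x y ⟩
      2# * (x * x + 1# * (y * y)) ∎
      where
      m = (1# - half) * x + half * y
      s : Carrier → Carrier
      s h = (2# - h) * x + h * y
      s-cong : ∀ {g h} → g ≈ h → s g ≈ s h
      s-cong g≈h = +-cong (*-congʳ (+-congˡ (-‿cong g≈h))) (*-congʳ g≈h)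

  midpoint∈ : {C : Pred (ℝ^ d) 0ℓ} → Convex C → ∀ {x y} → x ∈ C → y ∈ C → midpoint x y ∈ C
  midpoint∈ convex {x} {y} x∈C y∈C = convex x y half x∈C y∈C (proj₁ 0<half) (≤-by half
    (trans (+-congʳ (sym 2half≈1)) (solve 1 (λ h → :2 :* h :- h := h) refl half)) (proj₁ 0<half))
    where 0<half = proj₁ (proj₂ half-spec)

  module _ {C : Pred (ℝ^ d) 0ℓ} (convex : Convex C) where

    -- The midpoint of `x` and `y` lies in `C`, so its squared norm is at least μ. The parallelogram
    -- law then bounds the squared distance by 4 (μ + ε) - 4 μ.
    almost-nearest-close : ∀ {μ ε x y} → (∀ z → z ∈ C → μ ≤ norm² z) →
      x ∈ C → norm² x ≤ μ + ε → y ∈ C → norm² y ≤ μ + ε → distance² x y ≤ 2# * 2# * ε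
    almost-nearest-close {μ} {ε} {x} {y} μ≤ x∈C x≤ y∈C y≤ = ≤-by
      (2# * (μ + ε - norm² x) + 2# * (μ + ε - norm² y) + 2# * 2# * (norm² (midpoint x y) - μ))
      (begin
        2# * 2# * ε - D                                 ≈⟨ solve 3 (λ e d m → :2 :* :2 :* e :- d := :2 :* :2 :* e :- (d :+ :2 :* :2 :* m) :+ :2 :* :2 :* m)
                                                             refl ε D M ⟩
        2# * 2# * ε - (D + 2# * 2# * M) + 2# * 2# * M   ≈⟨ +-congʳ (+-congˡ (-‿cong (parallelogram x y))) ⟩
        2# * 2# * ε - 2# * (norm² x + 1# * norm² y) + 2# * 2# * M
          ≈⟨ solve 5 (λ e a b m u → :2 :* :2 :* e :- :2 :* (a :+ :1 :* b) :+ :2 :* :2 :* m :=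
                :2 :* (u :+ e :- a) :+ :2 :* (u :+ e :- b) :+ :2 :* :2 :* (m :- u)) refl ε (norm² x) (norm² y) M μ ⟩
        _ ∎)
      (+-nonNegative (+-nonNegative (*-nonNegative 0≤2 (x≤y⇒0≤y-x x≤)) (*-nonNegative 0≤2 (x≤y⇒0≤y-x y≤)))
        (*-nonNegative (*-nonNegative 0≤2 0≤2) (x≤y⇒0≤y-x (μ≤ _ (midpoint∈ convex x∈C y∈C)))))
      where
      D = distance² x y
      M = norm² (midpoint x y)
      0≤2 = proj₁ 0<2

    nearest-unique : ∀ {p x} → p ∈ C → (∀ z → z ∈ C → norm² p ≤ norm² z) → x ∈ C → norm² x ≤ norm² p → x ≋ p
    nearest-unique {p} {x} p∈C p≤ x∈C x≤p i = begin
      x i              ≈⟨ solve 2 (λ x p → x := x :- p :+ p) refl (x i) (p i) ⟩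
      x i - p i + p i  ≈⟨ +-congʳ (square≤0⇒≈0 (≤-trans (term≤sum (λ i → square-nonNegative (x i - p i)) i) distance≤0)) ⟩
      0# + p i         ≈⟨ +-identityˡ (p i) ⟩
      p i              ∎
      where
      distance≤0 : distance² x p ≤ 0#
      distance≤0 = ≤-respʳ-≈ (zeroʳ _) (almost-nearest-close p≤ x∈C (≤-respʳ-≈ (sym (+-identityʳ _)) x≤p)
                     p∈C (≤-reflexive (sym (+-identityʳ _))))

  abstract
    -- Completeness speaks of suprema, so the infimum is obtained as the least upper bound of the
    -- lower bounds.
    infimum : {C : Pred (ℝ^ d) 0ℓ} → Satisfiable C →
      ∃[ μ ] (∀ z → z ∈ C → μ ≤ norm² z) × (∀ ε → 0# < ε → ∃[ x ] x ∈ C × norm² x ≤ μ + ε)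
    infimum {C = C} (x₀ , x₀∈C) = μ , (λ z z∈C → proj₂ lub (norm² z) λ t t≤ → t≤ z z∈C) , approximate
      where
      LowerBound : Pred Carrier 0ℓ
      LowerBound t = ∀ z → z ∈ C → t ≤ norm² z
      lub-spec : Satisfiable (LeastUpperBound LowerBound)
      lub-spec = complete LowerBound (0# , λ z _ → sum-nonNegative λ i → square-nonNegative (z i))
                   (norm² x₀ , λ t t≤ → t≤ x₀ x₀∈C)
      μ : Carrier
      μ = proj₁ lub-spec
      lub : μ ∈ LeastUpperBound LowerBound
      lub = proj₂ lub-spec
      approximate : ∀ ε → 0# < ε → ∃[ x ] x ∈ C × norm² x ≤ μ + ε
      approximate ε 0<ε = decidable-stable em λ none → <⇒≱
        (<-by ε (solve 2 (λ m e → m :+ e :- m := e) refl μ ε) 0<ε)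
        (proj₁ lub (μ + ε) λ z z∈C → ≤-stable λ ≰ → none (z , z∈C , proj₁ (≰⇒> ≰)))

  module Nearest {C : Pred (ℝ^ d) 0ℓ} (closed : Closed C) (convex : Convex C) (satisfiable : Satisfiable C) where
    private
      inf-spec = infimum satisfiable
      μ = proj₁ inf-spec
      μ≤ = proj₁ (proj₂ inf-spec)
      approximate = proj₂ (proj₂ inf-spec)

    -- These nested sets have diameter at most 2δ and take the place of a minimising Cauchy
    -- sequence, so no sequence has to be chosen.
    Near : Carrier → Pred (ℝ^ d) 0ℓ
    Near δ x = x ∈ C × norm² x ≤ μ + δ * δ

    near-exists : ∀ {δ} → 0# < δ → ∃[ x ] x ∈ Near δ
    near-exists {δ} 0<δ = approximate (δ * δ) (*-positive 0<δ 0<δ)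

    near-mono : ∀ {δ ε} → 0# < δ → δ ≤ ε → Near δ ⊆ Near ε
    near-mono {δ} {ε} 0<δ δ≤ε (x∈C , x≤) = x∈C , ≤-trans x≤ (+-mono-≤ ≤-refl
      (≤-trans (*-monoˡ-≤ (proj₁ 0<δ) δ≤ε) (≤-respˡ-≈ (*-comm ε δ) (*-monoˡ-≤ (≤-trans (proj₁ 0<δ) δ≤ε) δ≤ε))))

    near-close : ∀ {δ x y} → 0# < δ → x ∈ Near δ → y ∈ Near δ → ∀ i → x i ≤ y i + 2# * δ
    near-close {δ} {x} {y} 0<δ (x∈C , x≤) (y∈C , y≤) i = ≤-by (2# * δ - (x i - y i))
      (solve 3 (λ x y e → y :+ e :- x := e :- (x :- y)) refl (x i) (y i) (2# * δ))
      (x≤y⇒0≤y-x (≤-from-squares (*-positive 0<2 0<δ) (≤-trans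
        (term≤sum (λ i → square-nonNegative (x i - y i)) i)
        (≤-respʳ-≈ (solve 1 (λ d → :2 :* :2 :* (d :* d) := :2 :* d :* (:2 :* d)) refl δ)
          (almost-nearest-close convex μ≤ x∈C x≤ y∈C y≤)))))

    -- The supremum of these `t` is the limit inferior of coordinate `i` over `Near δ` as δ tends to
    -- 0. It becomes that coordinate of the nearest point.
    EventuallyBelow : Fin d → Pred Carrier 0ℓ
    EventuallyBelow i t = ∃[ δ ] 0# < δ × (∀ x → x ∈ Near δ → t ≤ x i)

    near-lower : ∀ {δ x} → 0# < δ → x ∈ Near δ → ∀ i → EventuallyBelow i (x i - 2# * δ)
    near-lower {δ} {x} 0<δ near i = δ , 0<δ , λ y near′ → ≤-by (y i + 2# * δ - x i)
      (solve 3 (λ x y e → y :- (x :- e) := y :+ e :- x) refl (x i) (y i) (2# * δ))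
      (x≤y⇒0≤y-x (near-close 0<δ near near′ i))

    near-upper : ∀ {δ x} → 0# < δ → x ∈ Near δ → ∀ i → UpperBound (EventuallyBelow i) (x i + 2# * δ)
    near-upper {δ} {x} 0<δ near i t (δ′ , 0<δ′ , t≤) with total δ δ′
    ... | inj₁ δ≤δ′ = ≤-trans (t≤ x (near-mono 0<δ δ≤δ′ near)) (near-close 0<δ near near i)
    ... | inj₂ δ′≤δ with y , near′ ← near-exists 0<δ′ =
          ≤-trans (t≤ y near′) (near-close 0<δ (near-mono 0<δ′ δ′≤δ near′) near i)

    private
      nearest-spec : ∀ i → Satisfiable (LeastUpperBound (EventuallyBelow i))
      nearest-spec i with x , near ← near-exists 0<1 = complete (EventuallyBelow i)
        (_ , near-lower 0<1 near i) (_ , near-upper 0<1 near i)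

    nearest : ℝ^ d
    nearest i = proj₁ (nearest-spec i)

    nearest≤ : ∀ {δ x} → 0# < δ → x ∈ Near δ → ∀ i → nearest i ≤ x i + 2# * δ
    nearest≤ 0<δ near i = proj₂ (proj₂ (nearest-spec i)) _ (near-upper 0<δ near i)

    ≤nearest : ∀ {δ x} → 0# < δ → x ∈ Near δ → ∀ i → x i - 2# * δ ≤ nearest i
    ≤nearest 0<δ near i = proj₁ (proj₂ (nearest-spec i)) _ (near-lower 0<δ near i)

    private
      K : Carrier
      K = sum {d} (λ _ → 1#)

      0≤K : 0# ≤ K
      0≤K = sum-nonNegative {n = d} λ _ → 0≤1

    distance²-nearest : ∀ {δ x} → 0# < δ → x ∈ Near δ → distance² nearest x ≤ δ * δ * (2# * 2# * K)
    distance²-nearest {δ} {x} 0<δ near = ≤-respʳ-≈ total-bound (sum-mono-≤ coordinate)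
      where
      coordinate : ∀ i → (nearest i - x i) * (nearest i - x i) ≤ 2# * δ * (2# * δ) * 1#
      coordinate i = ≤-by ((nearest i - (x i - 2# * δ)) * (x i + 2# * δ - nearest i))
        (solve 3 (λ p x e → e :* e :* :1 :- (p :- x) :* (p :- x) := (p :- (x :- e)) :* (x :+ e :- p))
           refl (nearest i) (x i) (2# * δ))
        (*-nonNegative (x≤y⇒0≤y-x (≤nearest 0<δ near i)) (x≤y⇒0≤y-x (nearest≤ 0<δ near i)))

      total-bound : sum {d} (λ _ → 2# * δ * (2# * δ) * 1#) ≈ δ * δ * (2# * 2# * K)
      total-bound = trans (sym (*-distribˡ-sum {d} (2# * δ * (2# * δ)) (λ _ → 1#)))
        (solve 2 (λ s k → :2 :* s :* (:2 :* s) :* k := s :* s :* (:2 :* :2 :* k)) refl δ K)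

    nearest∈C : nearest ∈ C
    nearest∈C = closed λ ε 0<ε →
      let s , 0<s , _ , s²4K<ε² = small-square-factor 0<ε (*-nonNegative (*-nonNegative (proj₁ 0<2) (proj₁ 0<2)) 0≤K)
          x , near = near-exists 0<s
      in x , proj₁ near , ≤-<-trans (distance²-nearest 0<s near) s²4K<ε²

    -- The factor of δ depends on the limit point alone and not on `x`, so δ can tend to 0 in
    -- `nearest-minimal`.
    norm²-nearest≤near : ∀ {δ x} → 0# < δ → x ∈ Near δ → norm² nearest ≤ norm² x + 2# * δ * (norm² nearest + 1# * K)
    norm²-nearest≤near {δ} {x} 0<δ near = ≤-respʳ-≈ sums (sum-mono-≤ λ i → pointwise (≤nearest 0<δ near i) (nearest≤ 0<δ near i))
      where
      sums = trans (sum-+* (λ i → x i * x i) (λ i → nearest i * nearest i + 1# * 1#) (2# * δ))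
               (+-congˡ (*-congˡ (sum-+* {d} (λ i → nearest i * nearest i) (λ _ → 1#) 1#)))
      -- With h = p - x and |h| ≤ e, twice the gap is 2h² + (e - h) (p + 1)² + (e + h) (p - 1)².
      pointwise : ∀ {p x e} → x - e ≤ p → p ≤ x + e → p * p ≤ x * x + e * (p * p + 1# * 1#)
      pointwise {p} {x} {e} x-e≤p p≤x+e = 0≤y-x⇒x≤y (x+x-nonNegative⇒ (≤-respʳ-≈
        (solve 3 (λ p x e → :2 :* ((p :- x) :* (p :- x)) :+ (x :+ e :- p) :* ((p :+ :1) :* (p :+ :1)) :+ (p :- (x :- e)) :* ((p :- :1) :* (p :- :1)) :=
             x :* x :+ e :* (p :* p :+ :1 :* :1) :- p :* p :+ (x :* x :+ e :* (p :* p :+ :1 :* :1) :- p :* p)) refl p x e)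
        (+-nonNegative (+-nonNegative (*-nonNegative (proj₁ 0<2) (square-nonNegative _))
          (*-nonNegative (x≤y⇒0≤y-x p≤x+e) (square-nonNegative _)))
          (*-nonNegative (x≤y⇒0≤y-x x-e≤p) (square-nonNegative _)))))

    nearest-minimal : ∀ z → z ∈ C → norm² nearest ≤ norm² z
    nearest-minimal z z∈C = ≤-trans (≤-stable λ ≰μ →
      let gap = norm² nearest - μ
          0<gap : 0# < gap
          0<gap = x≤y⇒0≤y-x (proj₁ (≰⇒> ≰μ)) , λ 0≈gap → proj₂ (≰⇒> ≰μ)
            (trans (sym (+-identityˡ μ)) (trans (+-congʳ 0≈gap) (solve 2 (λ n m → n :- m :+ m := n) refl (norm² nearest) μ)))
          -- With N = `norm² nearest`, the bound N ≤ μ + s² + 2s (N + K) and s² ≤ s give gap ≤ s (1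
          -- + 2 (N + K)), which this choice of `s` contradicts.
          s , 0<s , s≤1 , s*a<gap = small-factor 0<gap 0≤a
          x , near = near-exists 0<s
          s²≤s = ≤-respʳ-≈ (*-identityʳ s) (*-monoˡ-≤ (proj₁ 0<s) s≤1)
      in <⇒≱ s*a<gap (≤-by (μ + s * s + 2# * s * (norm² nearest + 1# * K) - norm² nearest + (s - s * s))
           (solve 4 (λ s n k m → s :* (:1 :+ :2 :* (n :+ :1 :* k)) :- (n :- m) :=
              m :+ s :* s :+ :2 :* s :* (n :+ :1 :* k) :- n :+ (s :- s :* s)) refl s (norm² nearest) K μ)
           (+-nonNegative (x≤y⇒0≤y-x (≤-trans (norm²-nearest≤near 0<s near) (+-mono-≤ (proj₂ near) ≤-refl)))
             (x≤y⇒0≤y-x s²≤s))))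
      (μ≤ z z∈C)
      where
      0≤a : 0# ≤ 1# + 2# * (norm² nearest + 1# * K)
      0≤a = +-nonNegative 0≤1 (*-nonNegative (proj₁ 0<2) (+-nonNegative
        (sum-nonNegative λ i → square-nonNegative (nearest i)) (≤-respʳ-≈ (sym (*-identityˡ K)) 0≤K)))

  abstract
    nearest-point : {C : Pred (ℝ^ d) 0ℓ} → Closed C → Convex C → Satisfiable C →
      ∃[ p ] p ∈ C × (∀ z → z ∈ C → norm² p ≤ norm² z)
    nearest-point closed convex satisfiable = nearest , nearest∈C , nearest-minimal
      where open Nearest closed convex satisfiable

-- The colorful Helly theorem modulo a subspace.

module ColorfulHelly (em : ExcludedMiddle 0ℓ) (ℝ : CompleteOrderedField) where
  open CompleteOrderedField ℝ hiding (zero)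
  open EuclideanSpace ℝ
  open OrderedField em ℝ
  open RankModulo em ℝ
  open ConvexSets em ℝ
  open NearestPoints em ℝ

  private variable
    m n d u : ℕ

  argmax : Fin n → (f : Fin n → Carrier) → ∃[ i ] ∀ j → f j ≤ f i
  argmax {suc zero}    _ f = zero , λ { zero → ≤-refl }
  argmax {suc (suc n)} _ f with i , max ← argmax zero (f ∘ suc) with total (f zero) (f (suc i))
  ... | inj₁ f₀≤fᵢ = suc i , λ { zero → f₀≤fᵢ ; (suc j) → max j }
  ... | inj₂ fᵢ≤f₀ = zero , λ { zero → ≤-refl ; (suc j) → ≤-trans (max j) fᵢ≤f₀ }

  Selection : (Fin m → ℕ) → Set
  Selection n = ∀ i → Fin (n i)

  module _ {n : Fin (suc m) → ℕ} where
    infixr 5 _∷ₛ_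
    _∷ₛ_ : Fin (n zero) → Selection (n ∘ suc) → Selection n
    (j ∷ₛ ρ) zero    = j
    (j ∷ₛ ρ) (suc i) = ρ i

    ∷ₛ-η : ∀ (τ : Selection n) {ρ} → (∀ i → ρ i ≡ τ (suc i)) → ∀ i → (τ zero ∷ₛ ρ) i ≡ τ i
    ∷ₛ-η τ ρ≗τ zero    = ≡.refl
    ∷ₛ-η τ ρ≗τ (suc i) = ρ≗τ i

  -- Without function extensionality f is bounded only up to pointwise equality of its arguments.
  Maximal : (n : Fin m → ℕ) → (Selection n → Carrier) → Carrier → Set
  Maximal n f v = ∀ (τ : Selection n) → Σ[ τ′ ∈ Selection n ] (∀ i → τ′ i ≡ τ i) × f τ′ ≤ v

  abstract
    argmax-selection : {n : Fin m → ℕ} → Selection n → (f : Selection n → Carrier) → ∃[ σ ] Maximal n f (f σ)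
    argmax-selection {zero}      σ₀ f = σ₀ , λ τ → σ₀ , (λ ()) , ≤-refl
    argmax-selection {suc m} {n} σ₀ f = proj₁ maximum ∷ₛ best (proj₁ maximum) , maximal
      where
      restricted : ∀ j → ∃[ ρ ] Maximal (n ∘ suc) (λ ρ → f (j ∷ₛ ρ)) (f (j ∷ₛ ρ))
      restricted j = argmax-selection {n = n ∘ suc} (σ₀ ∘ suc) λ ρ → f (j ∷ₛ ρ)
      best : Fin (n zero) → Selection (n ∘ suc)
      best j = proj₁ (restricted j)
      maximum : ∃[ i ] ∀ j → f (j ∷ₛ best j) ≤ f (i ∷ₛ best i)
      maximum = argmax (σ₀ zero) λ j → f (j ∷ₛ best j)
      maximal : Maximal n f (f (proj₁ maximum ∷ₛ best (proj₁ maximum)))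
      maximal τ =
        let τ′ , τ′≗τ , ≤best = proj₂ (restricted (τ zero)) (τ ∘ suc)
        in τ zero ∷ₛ τ′ , ∷ₛ-η τ τ′≗τ , ≤-trans ≤best (proj₂ maximum (τ zero))

    argmax-family : {n : Fin m → ℕ} → Fin u → Selection n → (f : Fin u → Selection n → Carrier) →
      ∃[ a ] ∃[ σ ] ∀ b → Maximal n (f b) (f a σ)
    argmax-family {u = u} {n = n} a₀ σ₀ f = proj₁ maximum , best (proj₁ maximum) , λ b τ →
      let τ′ , τ′≗τ , ≤best = proj₂ (restricted b) τ
      in τ′ , τ′≗τ , ≤-trans ≤best (proj₂ maximum b)
      where
      restricted : ∀ a → ∃[ σ ] Maximal n (f a) (f a σ)
      restricted a = argmax-selection σ₀ (f a)
      best : Fin u → Selection n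
      best a = proj₁ (restricted a)
      maximum : ∃[ a ] ∀ b → f b (best b) ≤ f a (best a)
      maximum = argmax a₀ λ a → f a (best a)

  closed-respects : {S : Pred (ℝ^ d) 0ℓ} → Closed S → Respects S
  closed-respects closed {x} x≋y x∈S = closed λ ε 0<ε → x , x∈S ,
    ≤-<-trans (≤-reflexive (sum-zero λ i → trans (*-congˡ (trans (+-congʳ (sym (x≋y i))) (-‿inverseʳ (x i)))) (zeroʳ _)))
      (*-positive 0<ε 0<ε)

  module _ {I : Set} {S : I → Pred (ℝ^ d) 0ℓ} where
    ⋂-closed : (∀ i → Closed (S i)) → Closed (⋂ I S)
    ⋂-closed closed adherent i = closed i λ ε 0<ε →
      let y , y∈S , near = adherent ε 0<ε in y , y∈S i , near

    ⋂-convex : (∀ i → Convex (S i)) → Convex (⋂ I S)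
    ⋂-convex convex x y t x∈S y∈S 0≤t t≤1 i = convex i x y t (x∈S i) (y∈S i) 0≤t t≤1

  module _ {L : Pred (ℝ^ d) 0ℓ} (L-sub : IsSubspace L) (codim : ¬ Codim≥ L (suc u))
           {n : Fin (suc u) → ℕ} (σ₀ : ∀ a → Fin (n a))
           (G : ∀ a → Fin (n a) → Pred (ℝ^ d) 0ℓ)
           (closed : ∀ a j → Closed (G a j)) (convex : ∀ a j → Convex (G a j))
           (invariant : ∀ a j x l → x ∈ G a j → l ∈ L → (λ i → x i + l i) ∈ G a j)
           (rainbow : (σ : ∀ a → Fin (n a)) → Satisfiable (⋂ (Fin (suc u)) λ a → G a (σ a))) where

    private
      Partial : Fin (suc u) → (∀ a → Fin (n a)) → Pred (ℝ^ d) 0ℓ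
      Partial a σ x = ∀ b → b ≢ a → x ∈ G b (σ b)

      partial-closed : ∀ a σ → Closed (Partial a σ)
      partial-closed a σ = ⋂-closed {S = λ b x → b ≢ a → x ∈ G b (σ b)} λ b → ⋂-closed {S = λ _ → G b (σ b)} λ _ → closed b (σ b)

      partial-convex : ∀ a σ → Convex (Partial a σ)
      partial-convex a σ = ⋂-convex {S = λ b x → b ≢ a → x ∈ G b (σ b)} λ b → ⋂-convex {S = λ _ → G b (σ b)} λ _ → convex b (σ b)

      nearest : ∀ a σ → ∃[ p ] p ∈ Partial a σ × (∀ z → z ∈ Partial a σ → norm² p ≤ norm² z)
      nearest a σ = nearest-point (partial-closed a σ) (partial-convex a σ)
        (proj₁ (rainbow σ) , λ b _ → proj₂ (rainbow σ) b)

      value : Fin (suc u) → (∀ a → Fin (n a)) → Carrier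
      value a σ = norm² (proj₁ (nearest a σ))

      best : ∃[ a ] ∃[ σ ] ∀ b → Maximal n (value b) (value a σ)
      best = argmax-family zero σ₀ value

      a* : Fin (suc u)
      a* = proj₁ best

      σ* : Selection n
      σ* = proj₁ (proj₂ best)

      x* : ℝ^ d
      x* = proj₁ (nearest a* σ*)

      x*-maximal : ∀ a → Maximal n (value a) (norm² x*)
      x*-maximal = proj₂ (proj₂ best)

      module _ (j : Fin (n a*)) where
        τ : ∀ b → Fin (n b)
        τ b with b ≟ a*
        ... | yes ≡.refl = j
        ... | no _       = σ* b

        τ-at : τ a* ≡ j
        τ-at with a* ≟ a*
        ... | yes ≡.refl = ≡.refl
        ... | no a≢a     = contradiction ≡.refl a≢a

        τ-off : ∀ b → b ≢ a* → τ b ≡ σ* b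
        τ-off b b≢a with b ≟ a*
        ... | yes b≡a = contradiction b≡a b≢a
        ... | no _    = ≡.refl

        q : ∀ b → ∃[ x ] norm² x ≤ norm² x* × (∀ c → c ≢ b → x ∈ G c (τ c))
        q b with τ′ , τ′≗τ , ≤x* ← x*-maximal b τ = proj₁ (nearest b τ′) , ≤x* ,
          λ c c≢b → subst (λ j → proj₁ (nearest b τ′) ∈ G c j) (τ′≗τ c) (proj₁ (proj₂ (nearest b τ′)) c c≢b)

        -- Recolour `a*` by `j`. By maximality each point `q b`, which may miss only colour `b`,
        -- still lies in the ball of radius ∣x*∣ about the origin. Radon's theorem, with that ball
        -- as the set that the rainbow point may miss, yields `z` in the ball and in all the sets of
        -- `τ`. In particular `z` competes with `x*` in `Partial a* σ*`, so by uniqueness of nearest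
        -- points it is `x*`; and `z` lies in `G a* j`.
        x*∈ : x* ∈ G a* j
        x*∈ = closed-respects (closed a* j)
          (nearest-unique (partial-convex a* σ*) (proj₁ (proj₂ (nearest a* σ*))) (proj₂ (proj₂ (nearest a* σ*)))
            (λ b b≢a → subst (λ j → z ∈ G b j) (τ-off b b≢a) (z∈G b)) z≤x*)
          (subst (λ j → z ∈ G a* j) τ-at (z∈G a*))
          where
          z-spec : ∃[ z ] norm² z ≤ norm² x* × (∀ b → z ∈ G b (τ b))
          z-spec = radon {B = λ z → norm² z ≤ norm² x*} {S = λ b → G b (τ b)} L-sub
            (ball-convex (norm² x*)) (λ b → convex b (τ b)) (λ b → closed-respects (closed b (τ b))) (λ b → invariant b (τ b))
            (proj₁ ∘ q) (proj₁ (rainbow τ)) (λ b → proj₁ (proj₂ (q b))) (λ b c c≢b → proj₂ (proj₂ (q c)) b (c≢b ∘ ≡.sym))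
            (proj₂ (rainbow τ)) codim
          z = proj₁ z-spec
          z≤x* = proj₁ (proj₂ z-spec)
          z∈G = proj₂ (proj₂ z-spec)

    -- Among the nearest points to the origin of the intersections missing one colour,
    -- one of maximal norm lies in every set of its missing colour.
    abstract
      colorful-helly : ∃[ a ] Satisfiable (⋂ (Fin (n a)) (G a))
      colorful-helly = a* , x* , x*∈

-- Lineality spaces of closed convex sets.

module Lineality (em : ExcludedMiddle 0ℓ) (ℝ : CompleteOrderedField) where
  open CompleteOrderedField ℝ hiding (zero)
  open EuclideanSpace ℝ
  open OrderedField em ℝ
  open RankModulo em ℝ
  open ConvexSets em ℝ
  open ColorfulHelly em ℝ
  open import Algebra.Properties.Semiring.Sum semiring
  open import Relation.Binary.Reasoning.Setoid setoid

  private variable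
    k d : ℕ

  Lineality : Pred (ℝ^ d) 0ℓ → Pred (ℝ^ d) 0ℓ
  Lineality S v = ∀ x → x ∈ S → ∀ t → (λ i → x i + t * v i) ∈ S

  Lineality-isSubspace : {S : Pred (ℝ^ d) 0ℓ} → Respects S → IsSubspace (Lineality S)
  Lineality-isSubspace resp = record
    { respects = λ v≋w v∈ x x∈S t → resp (λ i → +-congˡ (*-congˡ (v≋w i))) (v∈ x x∈S t)
    ; 0∈       = λ x x∈S t → resp (λ i → solve 2 (λ x t → x := x :+ t :* :0) refl (x i) t) x∈S
    ; +*∈      = λ {v} {w} s v∈ w∈ x x∈S t → resp
        (λ i → solve 5 (λ x v w s t → x :+ t :* v :+ t :* s :* w := x :+ t :* (v :+ s :* w)) refl (x i) (v i) (w i) s t)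
        (w∈ _ (v∈ x x∈S t) (t * s))
    }

  -- x + t v is the limit as s → 0 of the points (1 - s) x + s (b + (t / s) v).
  line⇒lineality : {S : Pred (ℝ^ d) 0ℓ} → Closed S → Convex S → ∀ b v →
    (∀ t → (λ i → b i + t * v i) ∈ S) → v ∈ Lineality S
  line⇒lineality closed convex b v line x x∈S t = closed λ ε 0<ε →
    let s , 0<s , s≤1 , s²D<ε² = small-square-factor 0<ε (sum-nonNegative λ i → square-nonNegative (x i - b i))
        s⁻¹ , _ , ss⁻¹≈1 = positive-inverse 0<s
    in _ , convex x (λ i → b i + t * s⁻¹ * v i) s x∈S (line (t * s⁻¹)) (proj₁ 0<s) s≤1 ,
       ≤-<-trans (≤-reflexive (distance s s⁻¹ ss⁻¹≈1)) s²D<ε²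
    where
    distance : ∀ s s⁻¹ → s * s⁻¹ ≈ 1# →
      distance² (λ i → x i + t * v i) (λ i → (1# - s) * x i + s * (b i + t * s⁻¹ * v i)) ≈ s * s * distance² x b
    distance s s⁻¹ ss⁻¹≈1 = begin
      sum (λ i → (x i + t * v i - y i) * (x i + t * v i - y i))   ≈⟨ sum-cong-≋ (λ i → *-cong (difference i) (difference i)) ⟩
      sum (λ i → s * (x i - b i) * (s * (x i - b i)))             ≈⟨ sum-cong-≋ (λ i → solve 2 (λ s e → s :* e :* (s :* e) := s :* s :* (e :* e)) refl s (x i - b i)) ⟩
      sum (λ i → s * s * ((x i - b i) * (x i - b i)))             ≈⟨ *-distribˡ-sum (s * s) (λ i → (x i - b i) * (x i - b i)) ⟨
      s * s * distance² x b                                       ∎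
      where
      y : ℝ^ _
      y i = (1# - s) * x i + s * (b i + t * s⁻¹ * v i)

      difference : ∀ i → x i + t * v i - ((1# - s) * x i + s * (b i + t * s⁻¹ * v i)) ≈ s * (x i - b i)
      difference i = begin
        x i + t * v i - ((1# - s) * x i + s * (b i + t * s⁻¹ * v i))
          ≈⟨ solve 6 (λ x b v s s⁻¹ t → x :+ t :* v :- ((:1 :- s) :* x :+ s :* (b :+ t :* s⁻¹ :* v)) :=
               s :* (x :- b) :+ (:1 :- s :* s⁻¹) :* (t :* v)) refl (x i) (b i) (v i) s s⁻¹ t ⟩
        s * (x i - b i) + (1# - s * s⁻¹) * (t * v i)
          ≈⟨ +-congˡ (*-congʳ (+-congˡ (-‿cong ss⁻¹≈1))) ⟩
        s * (x i - b i) + (1# - 1#) * (t * v i)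
          ≈⟨ solve 2 (λ e f → e :+ (:1 :- :1) :* f := e) refl (s * (x i - b i)) (t * v i) ⟩
        s * (x i - b i) ∎

  flat⇒lineality : {S : Pred (ℝ^ d) 0ℓ} → Closed S → Convex S → (A : Flat k d) → Flat.points A ⊆ S →
    ∀ j → Flat.direction A j ∈ Lineality S
  flat⇒lineality closed convex A A⊆S j = line⇒lineality closed convex base (direction j) λ t →
    A⊆S ((λ l → t * unitVector j l) , λ i → +-congˡ (sym (begin
      sum (λ l → t * unitVector j l * direction l i)     ≈⟨ sum-cong-≋ (λ l → *-assoc t (unitVector j l) (direction l i)) ⟩
      sum (λ l → t * (unitVector j l * direction l i))   ≈⟨ *-distribˡ-sum t (λ l → unitVector j l * direction l i) ⟨
      t * sum (λ l → unitVector j l * direction l i)     ≈⟨ *-congˡ (sum-unitVector (λ l → direction l i) j) ⟩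
      t * direction j i                                  ∎)))
    where open Flat A

  -- A subspace `L` of codimension at most d - k contains `k` independent vectors, because `Null`
  -- has codimension d. They span the flat through `p`, which stays in every `S j` by invariance.
  lineality⇒flat : {J : Set} {S : J → Pred (ℝ^ d) 0ℓ} {L : Pred (ℝ^ d) 0ℓ} → (∀ j → Respects (S j)) →
    k ℕ.≤ d → IsSubspace L → ¬ Codim≥ L (suc (d ∸ k)) → (∀ j → L ⊆ Lineality (S j)) →
    Satisfiable (⋂ J S) → ContainsFlat k (⋂ J S)
  lineality⇒flat {d = d} {k} {L = L} resp k≤d L-sub codim L⊆ (p , p∈S)
    with v , v∈L , indep ← independent-within Null-isSubspace L-sub codim k
           (subst (Codim≥ Null) (≡.sym (ℕ.m+[n∸m]≡n k≤d)) Codim≥-Null) =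
    record { base = p ; direction = v ; independent = indep } , λ { (c , x≋) j → resp j
      (λ i → trans (+-congˡ (*-identityˡ _)) (sym (x≋ i)))
      (L⊆ j (IsSubspace.combination∈ L-sub {c = c} v∈L) p (p∈S j) 1#) }

-- Combining the transversal theorem with colorful Helly.

module FlatTransversals (em : ExcludedMiddle 0ℓ) (ℝ : CompleteOrderedField) where
  open CompleteOrderedField ℝ hiding (zero)
  open Vector using ([])
  open EuclideanSpace ℝ
  open RankModulo em ℝ
  open ConvexSets em ℝ using (Respects)
  open ColorfulHelly em ℝ
  open Lineality em ℝ
  open Transversals em ℝ
  open FiniteSubsets

  -- Injectivity of `e` makes the prescribed value unambiguous; indices outside its image get the
  -- default `σ₀`.
  extend : ∀ {s m} {n : Fin m → ℕ} (e : Fin s → Fin m) → Injective _≡_ _≡_ e → (∀ i → Fin (n i)) →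
    (ρ : ∀ a → Fin (n (e a))) → Σ[ σ ∈ (∀ i → Fin (n i)) ] ∀ a → σ (e a) ≡ ρ a
  extend {n = n} e e-inj σ₀ ρ = σ , σ∘e
    where
    σ : ∀ i → Fin (n i)
    σ i with any? (λ a → e a ≟ i)
    ... | yes (a , ea≡i) = subst (Fin ∘ n) ea≡i (ρ a)
    ... | no _           = σ₀ i
    σ∘e : ∀ a → σ (e a) ≡ ρ a
    σ∘e a with any? (λ a′ → e a′ ≟ e a)
    ... | no none = contradiction (a , ≡.refl) none
    ... | yes (a′ , ea′≡ea) with e-inj ea′≡ea
    σ∘e a | yes (a , ≡.refl) | ≡.refl = ≡.refl

  module _ {k d : ℕ} (k≤d : k ℕ.≤ d) {n : Fin (suc (d ∸ k)) → ℕ} (F : ∀ i → Fin (n i) → Pred (ℝ^ d) 0ℓ)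
           (closed : ∀ i j → Closed (F i j)) (convex : ∀ i j → Convex (F i j))
           (flats : (σ : ∀ i → Fin (n i)) → ContainsFlat k (⋂ (Fin (suc (d ∸ k))) (λ i → F i (σ i)))) where

    M : Fin (suc (d ∸ k)) → Pred (ℝ^ d) 0ℓ
    M i = ⋂ (Fin (n i)) (Lineality ∘ F i)

    F-respects : ∀ i j → Respects (F i j)
    F-respects i j = closed-respects (closed i j)

    L-sub : ∀ i j → IsSubspace (Lineality (F i j))
    L-sub i j = Lineality-isSubspace (F-respects i j)

    MI-sub : ∀ I → IsSubspace (Meet M I)
    MI-sub = Meet-isSubspace λ i → ⋂-isSubspace (L-sub i)

    -- The `k` directions of the flat shared by the selected sets lie in all their lineality spaces.
    -- Added to d - k + 1 vectors independent modulo the intersection of those spaces, they would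
    -- make d + 1 independent vectors in ℝ^d.
    ¬transversal : ∀ σ → ¬ Codim≥ (⋂ (Fin (suc (d ∸ k))) λ i → Lineality (F i (σ i))) (suc (d ∸ k))
    ¬transversal σ codim with A , A⊆F ← flats σ = ¬Codim≥-Null
      (subst (Codim≥ Null) (cong suc (ℕ.m∸n+n≡m k≤d))
        (Codim≥-append Null-isSubspace ⋂L-sub (λ x≋0 → IsSubspace.respects ⋂L-sub (λ i → sym (x≋0 i)) (IsSubspace.0∈ ⋂L-sub)) codim
          (λ j i → flat⇒lineality (closed i (σ i)) (convex i (σ i)) A (λ x∈A → A⊆F x∈A i) j)
          (Flat.independent A)))
      where
      ⋂L-sub : IsSubspace (⋂ (Fin (suc (d ∸ k))) λ i → Lineality (F i (σ i)))
      ⋂L-sub = ⋂-isSubspace λ i → L-sub i (σ i)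

    module _ (σ₀ : ∀ i → Fin (n i)) where

      subfamily-rainbow : ∀ {s} (e : Fin s → Fin (suc (d ∸ k))) → Injective _≡_ _≡_ e →
        ∀ ρ → Satisfiable (⋂ (Fin s) λ a → F (e a) (ρ a))
      subfamily-rainbow e e-inj ρ with σ , σ∘e ← extend e e-inj σ₀ ρ with A , A⊆F ← flats σ =
        _ , λ a → subst (λ j → _ ∈ F (e a) j) (σ∘e a) (A⊆F ((λ _ → 0#) , λ _ → refl) (e a))

      -- The size of `I` is passed as a separate `s` so that it can be matched: colorful Helly needs
      -- it as a successor.
      from-violation : ∀ I s → s ≡ ∣ I ∣ → (e : Fin s → Fin (suc (d ∸ k))) → Injective _≡_ _≡_ e →
        (∀ a → e a Subset.∈ I) → ¬ Codim≥ (Meet M I) s → ∃[ i ] ContainsFlat k (⋂ (Fin (n i)) (F i))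
      -- The empty list of vectors always witnesses codimension at least 0.
      from-violation I zero    _    e e-inj e∈I codim = contradiction ([] , λ _ _ ()) codim
      from-violation I (suc u) size e e-inj e∈I codim =
        e a , lineality⇒flat (F-respects (e a)) k≤d (MI-sub I)
          -- There are only d - k + 1 families, so codimension below ∣ I ∣ means at most d - k,
          -- leaving room for a `k`-flat.
          (codim ∘ Codim≥-antitone (MI-sub I) (subst (ℕ._≤ suc (d ∸ k)) (≡.sym size) (∣p∣≤n I)))
          (λ j x∈M → x∈M (e a) (e∈I a) j) (proj₂ good)
        where
        good : ∃[ a ] Satisfiable (⋂ (Fin (n (e a))) (F (e a)))
        good = colorful-helly (MI-sub I) codim (σ₀ ∘ e) (F ∘ e) (closed ∘ e) (convex ∘ e)
          (λ a j x l x∈F l∈M → F-respects (e a) j (λ i → +-congˡ (*-identityˡ (l i))) (l∈M (e a) (e∈I a) j x x∈F 1#))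
          (subfamily-rainbow e e-inj)
        a = proj₁ good

      nonempty-families : ∃[ i ] ContainsFlat k (⋂ (Fin (n i)) (F i))
      nonempty-families = decidable-stable em λ none →
        let σ , codim = transversal (λ i j → Lineality (F i j)) L-sub λ I → decidable-stable em λ ¬codim →
              let e , e-inj , e∈I = enumerate I
              in none (from-violation I ∣ I ∣ ≡.refl e e-inj e∈I ¬codim)
        in ¬transversal σ codim

    empty-family : ∀ i → ¬ Fin (n i) → ContainsFlat k (⋂ (Fin (n i)) (F i))
    empty-family i empty = lineality⇒flat {L = U} (λ j → contradiction j empty) k≤d U-isSubspace
      (¬Codim≥-U ∘ Codim≥-antitone U-isSubspace (ℕ.s≤s ℕ.z≤n)) (λ j → contradiction j empty)
      ((λ _ → 0#) , λ j → contradiction j empty)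

    -- An empty family has intersection ℝ^d and settles the claim by itself. Otherwise choosing a
    -- member of each family gives the default selection needed to extend partial ones.
    colorful-flats : ∃[ i ] ContainsFlat k (⋂ (Fin (n i)) (F i))
    colorful-flats = decidable-stable em λ none → none
      (nonempty-families λ i → decidable-stable em λ empty → none (i , empty-family i empty))

open import Data.Nat.Base using (_≤_)

theorem4 : ExcludedMiddle 0ℓ →
    (ℝ : CompleteOrderedField) → let open EuclideanSpace ℝ in
    (k d : ℕ) → k ≤ d →
    (n : Fin (suc (d ∸ k)) → ℕ) →
    (F : (i : Fin (suc (d ∸ k))) → Fin (n i) → Pred (ℝ^ d) 0ℓ) →
    (∀ i j → Closed (F i j)) →
    (∀ i j → Convex (F i j)) →
    ((σ : (i : Fin (suc (d ∸ k))) → Fin (n i)) → ContainsFlat k (⋂ (Fin (suc (d ∸ k))) (λ i → F i (σ i)))) →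
    ∃[ i ] ContainsFlat k (⋂ (Fin (n i)) (F i))
theorem4 em ℝ k d k≤d n F closed convex flats = FlatTransversals.colorful-flats em ℝ k≤d F closed convex flats
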